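{- Let $k\ge 1$ and let $\Upsilon$ be a subset of $\mathcal{F}_{2,k}$. Then $$1+\sum_{n\ge 1}\frac{Alt^{\Upsilon}_{2n}t^{2n}}{(2kn)!}=\frac{1}{1+\sum_{n\ge 1}\frac{(-1)^{n}t^{2n}}{(2kn)!}\,full^{\Upsilon}_{2n}}$$ and $$\sum_{n\ge 1}\frac{Alt^{\Upsilon}_{2n-1}t^{2n-1}}{(k(2n-1))!}=\frac{\sum_{n\ge 1}\frac{(-1)^{n-1}t^{2n-1}}{(k(2n-1))!}\,full^{\Upsilon}_{2n-1}}{1+\sum_{n\ge 1}\frac{(-1)^{n}t^{2n}}{(2kn)!}\,full^{\Upsilon}_{2n}}.$$
   Context: $\mathcal{F}_{n,k}$ is the set of all fillings $F$ of the $k\times n$ rectangular array ($k$ rows, $n$ columns) with the integers $1,\dots,kn$, each used once, such that the elements in each column increase from bottom to top. For a filling of a $k\times n$ array by distinct positive integers with columns increasing from bottom to top, $\mathrm{red}(F)\in\mathcal{F}_{n,k}$ is obtained by replacing the $i$-th smallest entry by $i$. $F[i,i+1]$ is the $k\times 2$ filling formed by columns $i$ and $i+1$ of $F$. For $\Upsilon\subseteq\mathcal{F}_{2,k}$, $F\in\mathcal{F}_{n,k}$ has an $\Upsilon$-match starting at position $i$ ($1\le i\le n-1$) if $\mathrm{red}(F[i,i+1])\in\Upsilon$. $F\in\mathcal{F}_{n,k}$ is $\Upsilon$-alternating if $\mathrm{red}(F[2i+1,2i+2])\in\Upsilon$ for all integers $0\le i\le (n-2)/2$ and $\mathrm{red}(F[2i,2i+1])\notin\Upsilon$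 for all integers $0<i\le (n-1)/2$. $Alt^{\Upsilon}_n$ is the number of $\Upsilon$-alternating elements of $\mathcal{F}_{n,k}$. $full^{\Upsilon}_n$ is the number of $F\in\mathcal{F}_{n,k}$ with $\Upsilon$-matches starting at every position $1,\dots,n-1$, with $full^{\Upsilon}_1=1$ by convention. The identities are of formal power series in $t$ over $\mathbb{Q}$. -}

module Defs where

open import Level using (Level; 0ℓ)
open import Data.Nat.Base as ℕ using (ℕ; zero; suc; pred; _≤_; _<_; _∸_; _!; z≤n; s≤s)
import Data.Nat.Properties as ℕ
open import Data.Fin.Base using (Fin; zero; suc; toℕ; inject₁)
open import Data.Fin.Properties using (all?)
open import Data.Integer.Base using (ℤ; +_)
open import Data.List.Base as List using (List; []; _∷_; length; filter; applyUpTo; cartesianProductWith)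
open import Data.List.Membership.Propositional using (_∈_)
open import Data.List.Membership.Propositional.Properties
  using (∈-∃++; ∈-filter⁺; ∈-filter⁻; ∈-++⁺ˡ; ∈-++⁺ʳ; ∈-cartesianProductWith⁺)
open import Data.List.Membership.DecPropositional ℕ._≟_ using (_∈?_)
open import Data.List.Relation.Unary.Any using (here; there)
import Data.List.Relation.Unary.All as ListAll
import Data.List.Relation.Unary.AllPairs as ListAllPairs
open import Data.List.Relation.Unary.Unique.Propositional using (Unique)
import Data.List.Relation.Unary.Unique.Propositional.Properties as Unique
open import Data.List.Relation.Binary.Permutation.Propositional using (_↭_; ↭-refl; ↭-sym; ↭-trans; prep)
open import Data.List.Relation.Binary.Permutation.Propositional.Properties
  using (∈-resp-↭; shift; drop-mid; ¬x∷xs↭[])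
open import Data.Product.Base using (_×_; _,_; proj₁; proj₂)
open import Data.Rational.Base as ℚ using (ℚ; 0ℚ; 1ℚ; 1/_; _/_)
open import Data.Rational.Properties as ℚ using (+-0-commutativeMonoid)
open import Data.Vec.Base as Vec using (Vec; []; _∷_; lookup; head; concat; toList; count)
open import Data.Vec.Properties using (∷-injective; toList-++)
open import Data.Vec.Relation.Unary.All as All using (All; []; _∷_)
open import Data.Vec.Relation.Unary.Linked using (Linked; linked?)
open import Function.Base using (_∘_)
open import Function.Bundles using (_⇔_; mk⇔)
open import Relation.Binary.Definitions using () renaming (Decidable to Decidable₂)
open import Relation.Binary.PropositionalEquality
open import Relation.Nullary using (¬_; Dec; yes; no; ¬?; _×-dec_; _→-dec_)
open import Relation.Nullary.Decidable using (map′)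
open import Relation.Unary using (Pred; Decidable)

open import Algebra.Properties.CommutativeMonoid.Sum +-0-commutativeMonoid using (sum; sum-cong-≗)

private
  variable
    ℓ : Level
    A : Set ℓ
    k n : ℕ

-- An array with k rows and n columns is stored as its n columns from left
-- to right, each of them read from bottom to top.

Array : ℕ → ℕ → Set
Array k n = Vec (Vec ℕ k) n

entries : Array k n → List ℕ
entries F = toList (concat F)

Increasing : Pred (Vec ℕ k) 0ℓ
Increasing = Linked _<_

𝓕 : ∀ n k → Pred (Array k n) 0ℓ
𝓕 n k F = entries F ↭ applyUpTo suc (k ℕ.* n) × All Increasing F

-- The i-th smallest of a collection of distinct numbers is the one that has
-- exactly i of them less than or equal to it.

rank : Array k n → ℕ → ℕ
rank F x = count (ℕ._≤? x) (concat F)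

red : Array k n → Array k n
red F = Vec.map (Vec.map (rank F)) F

-- An element p of Fin (pred n) stands for the position suc (toℕ p), so that
-- positions are numbered 1, …, n - 1.

position : Fin n → ℕ
position p = suc (toℕ p)

-- Columns i and i + 1 of F, where i is the position of p.

_[_,+1] : Array k n → Fin (pred n) → Array k 2
_[_,+1] {n = suc _} F p = lookup F (inject₁ p) ∷ lookup F (suc p) ∷ []

HasMatchAt : Pred (Array k 2) ℓ → Array k n → Fin (pred n) → Set ℓ
HasMatchAt Υ F p = Υ (red (F [ p ,+1]))

Alternating : Pred (Array k 2) ℓ → Pred (Array k n) ℓ
Alternating Υ F =
  (∀ p i → position p ≡ 2 ℕ.* i ℕ.+ 1 → HasMatchAt Υ F p) ×
  (∀ p i → position p ≡ 2 ℕ.* i → ¬ HasMatchAt Υ F p)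

MatchesEverywhere : Pred (Array k 2) ℓ → Pred (Array k n) ℓ
MatchesEverywhere Υ F = ∀ p → HasMatchAt Υ F p

_↭?_ : Decidable₂ (_↭_ {A = ℕ})
[]       ↭? []       = yes ↭-refl
[]       ↭? (y ∷ ys) = no (¬x∷xs↭[] ∘ ↭-sym)
(x ∷ xs) ↭? ys with x ∈? ys
... | no x∉ys = no λ p → x∉ys (∈-resp-↭ p (here refl))
... | yes x∈ys with ∈-∃++ x∈ys
...   | as , bs , refl =
  map′ (λ p → ↭-trans (prep x p) (↭-sym (shift x as bs))) (drop-mid [] as) (xs ↭? (as List.++ bs))

𝓕? : ∀ n k → Decidable (𝓕 n k)
𝓕? n k F = (entries F ↭? applyUpTo suc (k ℕ.* n)) ×-dec All.all? (linked? ℕ._<?_) F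

private
  ∀-preimage? : ∀ {P : Set ℓ} (f : ℕ → ℕ) → (∀ i → i ≤ f i) → ∀ m → Dec P → Dec (∀ i → m ≡ f i → P)
  ∀-preimage? f i≤fi m P? =
    map′ (λ h i m≡fi → h {i} (s≤s (subst (i ≤_) (sym m≡fi) (i≤fi i))) m≡fi) (λ h {i} _ → h i)
         (ℕ.allUpTo? (λ i → (m ℕ.≟ f i) →-dec P?) (suc m))

  i≤2i : ∀ i → i ≤ 2 ℕ.* i
  i≤2i i = ℕ.m≤m+n i _

  i≤2i+1 : ∀ i → i ≤ 2 ℕ.* i ℕ.+ 1
  i≤2i+1 i = ℕ.≤-trans (i≤2i i) (ℕ.m≤m+n _ 1)

alternating? : {Υ : Pred (Array k 2) ℓ} → Decidable Υ → Decidable (Alternating {n = n} Υ)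
alternating? Υ? F =
  all? (λ p → ∀-preimage? _ i≤2i+1 (position p) (Υ? _)) ×-dec
  all? (λ p → ∀-preimage? _ i≤2i (position p) (¬? (Υ? _)))

matchesEverywhere? : {Υ : Pred (Array k 2) ℓ} → Decidable Υ → Decidable (MatchesEverywhere {n = n} Υ)
matchesEverywhere? Υ? F = all? (λ p → Υ? _)

vectors : List A → ∀ n → List (Vec A n)
vectors xs zero    = [] ∷ []
vectors xs (suc n) = cartesianProductWith _∷_ xs (vectors xs n)

fillings : ∀ n k → List (Array k n)
fillings n k = filter (𝓕? n k) (vectors (vectors (applyUpTo suc (k ℕ.* n)) k) n)

Alt : {Υ : Pred (Array k 2) ℓ} → Decidable Υ → ℕ → ℕ
Alt {k = k} Υ? n = length (filter (alternating? Υ?) (fillings n k))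

full : {Υ : Pred (Array k 2) ℓ} → Decidable Υ → ℕ → ℕ
full         Υ? 1 = 1
full {k = k} Υ? n = length (filter (matchesEverywhere? Υ?) (fillings n k))

-- The list fillings n k contains every element of 𝓕 n k exactly once.

private
  ∈-vectors : ∀ {xs : List A} (v : Vec A n) → (∀ {x} → x ∈ toList v → x ∈ xs) → v ∈ vectors xs n
  ∈-vectors []      h = here refl
  ∈-vectors (x ∷ v) h = ∈-cartesianProductWith⁺ _∷_ (h (here refl)) (∈-vectors v (h ∘ there))

  vectors-unique : ∀ {xs : List A} → Unique xs → ∀ n → Unique (vectors xs n)
  vectors-unique xs! zero    = ListAll.[] ListAllPairs.∷ ListAllPairs.[]
  vectors-unique xs! (suc n) = Unique.cartesianProductWith⁺ _∷_ ∷-injective xs! (vectors-unique xs! n)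

  ∈-entries : ∀ (F : Array k n) {c x} → c ∈ toList F → x ∈ toList c → x ∈ entries F
  ∈-entries (c ∷ F) {x = x} (here refl) x∈c =
    subst (x ∈_) (sym (toList-++ c (concat F))) (∈-++⁺ˡ x∈c)
  ∈-entries (d ∷ F) {x = x} (there c∈F) x∈c =
    subst (x ∈_) (sym (toList-++ d (concat F))) (∈-++⁺ʳ (toList d) (∈-entries F c∈F x∈c))

∈-fillings : (F : Array k n) → F ∈ fillings n k ⇔ 𝓕 n k F
∈-fillings {k} {n} F = mk⇔
  (λ F∈ → proj₂ (∈-filter⁻ (𝓕? n k) {xs = vectors (vectors (applyUpTo suc (k ℕ.* n)) k) n} F∈))
  (λ F∈𝓕 → ∈-filter⁺ (𝓕? n k)
    (∈-vectors F λ c∈F → ∈-vectors _ λ x∈c → ∈-resp-↭ (proj₁ F∈𝓕) (∈-entries F c∈F x∈c)) F∈𝓕)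

fillings-unique : ∀ n k → Unique (fillings n k)
fillings-unique n k = Unique.filter⁺ (𝓕? n k) (vectors-unique (vectors-unique
  (Unique.applyUpTo⁺₁ suc (k ℕ.* n) λ i<j _ → ℕ.<⇒≢ i<j ∘ ℕ.suc-injective) k) n)

-- Formal power series over ℚ, given by their coefficients and compared
-- with _≗_

Series : Set
Series = ℕ → ℚ

infix  8 _⁻¹
infixl 7 _⊛_
infixl 6 _⊕_
infix  7 _t^_
infixl 7 _/!_

_/!_ : ℤ → ℕ → ℚ
a /! m = (a / (m !)) {{m ℕ.!≢0}}

_t^_ : ℚ → ℕ → Series
(c t^ e) m with m ℕ.≟ e
... | yes _ = c
... | no  _ = 0ℚ

𝟙 : Series
𝟙 = 1ℚ t^ 0

_⊕_ : Series → Series → Series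
(S ⊕ T) m = S m ℚ.+ T m

_⊛_ : Series → Series → Series
(S ⊛ T) m = sum {suc m} λ i → S (toℕ i) ℚ.* T (m ∸ toℕ i)

-- ∑ₙ≥₁ f is the infinite sum f 1 ⊕ f 2 ⊕ ⋯ of a family in which f n is
-- divisible by tⁿ: only f 1, …, f m then contribute to the coefficient of tᵐ.

∑ₙ≥₁ : (ℕ → Series) → Series
∑ₙ≥₁ f m = sum {m} λ i → f (suc (toℕ i)) m

-- The coefficients of the inverse of S up to degree n, highest degree first,
-- found by solving S ⊛ T ≗ 𝟙 for one coefficient of T after the other.

inverseCoefficients : (S : Series) .{{_ : ℚ.NonZero (S 0)}} → ∀ n → Vec ℚ (suc n)
inverseCoefficients S zero    = 1/ S 0 ∷ []
inverseCoefficients S (suc n) =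
  ℚ.- (1/ S 0 ℚ.* sum λ i → S (suc (toℕ i)) ℚ.* lookup cs i) ∷ cs
  where cs = inverseCoefficients S n

_⁻¹ : (S : Series) .{{_ : ℚ.NonZero (S 0)}} → Series
(S ⁻¹) n = head (inverseCoefficients S n)

private
  lookup-inverse : (S : Series) .{{_ : ℚ.NonZero (S 0)}} → ∀ n (i : Fin (suc n)) →
                   lookup (inverseCoefficients S n) i ≡ (S ⁻¹) (n ∸ toℕ i)
  lookup-inverse S zero    zero    = refl
  lookup-inverse S (suc n) zero    = refl
  lookup-inverse S (suc n) (suc i) = lookup-inverse S n i

⊛-inverseʳ : (S : Series) .{{_ : ℚ.NonZero (S 0)}} → S ⊛ S ⁻¹ ≗ 𝟙
⊛-inverseʳ S zero    = trans (ℚ.+-identityʳ _) (ℚ.*-inverseʳ (S 0))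
⊛-inverseʳ S (suc n) = begin
  S 0 ℚ.* (ℚ.- (1/ S 0 ℚ.* r)) ℚ.+ r′     ≡⟨ cong₂ ℚ._+_ (sym (ℚ.neg-distribʳ-* (S 0) _)) (sym r≡r′) ⟩
  ℚ.- (S 0 ℚ.* (1/ S 0 ℚ.* r)) ℚ.+ r      ≡⟨ cong (λ q → ℚ.- q ℚ.+ r) (sym (ℚ.*-assoc (S 0) (1/ S 0) r)) ⟩
  ℚ.- (S 0 ℚ.* 1/ S 0 ℚ.* r) ℚ.+ r        ≡⟨ cong (λ q → ℚ.- (q ℚ.* r) ℚ.+ r) (ℚ.*-inverseʳ (S 0)) ⟩
  ℚ.- (1ℚ ℚ.* r) ℚ.+ r                    ≡⟨ cong (λ q → ℚ.- q ℚ.+ r) (ℚ.*-identityˡ r) ⟩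
  ℚ.- r ℚ.+ r                             ≡⟨ ℚ.+-inverseˡ r ⟩
  0ℚ                                      ∎
  where
  open ≡-Reasoning
  r r′ : ℚ
  r  = sum λ i → S (suc (toℕ i)) ℚ.* lookup (inverseCoefficients S n) i
  r′ = sum {suc n} λ i → S (suc (toℕ i)) ℚ.* (S ⁻¹) (n ∸ toℕ i)
  r≡r′ : r ≡ r′
  r≡r′ = sum-cong-≗ λ i → cong (S (suc (toℕ i)) ℚ.*_) (lookup-inverse S n i)

module Submission where

-- Write α n = Alt n / (kn)! and φ n = full n / (kn)!, with φ 0 = 1.  Compared
-- coefficient by coefficient, both formulas are cases of one recurrence: for
-- m ≥ 1, the sum over the even numbers j ≤ m of
--
--   α j · c (m - j) · φ (m - j)
--
-- is c 1 · α m if m is odd, and 0 if m is even.  Here c satisfies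
-- c (r + 2) = - c r, and starts with 1, 0 for the first formula and with 0, 1
-- for the second one.
--
-- The recurrence has two ingredients.  The first one is that α and φ behave
-- like probabilities.  A filling with a + b columns amounts to a choice of the
-- ka numbers that go into its first a columns, an arrangement of these
-- numbers, and an arrangement of the remaining ones.  Conditions that depend
-- only on the relative order of the entries do not see which numbers have been
-- chosen, and there are (k(a + b))! / ((ka)! (kb)!) choices, so that the
-- frequency of "u on the first a columns and v on the last b" is the product
-- of the frequencies of u and v (frequency-split).  Having a match is such a
-- condition by red-map.  The count uses a recursive enumeration by first
-- columns; that it yields the elements of the list of all fillings is
-- fillings↭arrangements.
--
-- The second ingredient is a cancellation inside a single filling F with m
-- columns (cutSum-alternating).  Cut F after an even number j of columns, in
-- such a way that the part before the cut is alternating and the part after it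
-- has matches everywhere, and count the cut with the weight c (m - j).  If F
-- has no match at position j, as is the case for j = 0, and j + 2 ≤ m, then the
-- cut at j is admissible exactly if the one at j + 2 is and F has a match at
-- j + 2 or ends there.  These two cuts cancel, and so do all of them, with one
-- exception: if m is odd, then the cut at m - 1 without a match at m - 1 has no
-- counterpart.  It occurs exactly if F is alternating.
--
-- Summing over F gives the recurrence (convolution-suc).  The first formula
-- follows because the inverse of a power series is unique, and the second one
-- by substituting the first.

open import Defs
open import Algebra.Bundles using (CommutativeRing)
open import Data.Bool.Base using (Bool; true; false; not; _∧_; if_then_else_)
open import Data.Fin.Base as Fin using (Fin; zero; suc; toℕ; opposite)
open import Data.Fin.Permutation using (reverse)
open import Data.Fin.Properties using (all?; toℕ<n; toℕ≤pred[n]; opposite-prop; toℕ-injective; toℕ-fromℕ<)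
open import Data.Integer.Base as ℤ using (ℤ; +_; -1ℤ)
import Data.Integer.Properties as ℤ
open import Data.List.Base as List
  using (List; []; _∷_; _++_; length; concatMap; foldr; filter; upTo; applyUpTo)
open import Data.List.Membership.Propositional using (_∈_)
open import Data.List.Membership.Propositional.Properties
  using (∈-∃++; ∈-++⁺ˡ; ∈-++⁺ʳ; ∈-++⁻; ∈-map⁻; ∈-map⁺; ∈-concatMap⁺)
open import Data.List.Membership.Propositional.Properties.WithK using (unique∧set⇒bag)
open import Data.List.Properties
  using (length-++; length-map; length-upTo; length-applyUpTo; map-++; map-∘; map-applyUpTo)
open import Data.List.Relation.Binary.BagAndSetEquality using (∼bag⇒↭)
open import Data.List.Relation.Binary.Permutation.Propositional as ↭
  using (_↭_; ↭-refl; ↭-sym; ↭-trans; prep; swap)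
open import Data.List.Relation.Binary.Permutation.Propositional.Properties
  using (↭-length; shift; ∈-resp-↭; drop-∷; ++⁺ˡ; ¬x∷xs↭[])
open import Data.List.Relation.Binary.Sublist.Propositional as Sublist
  using ([]; _∷_; _∷ʳ_; ⊆-refl; minimum)
open import Data.List.Relation.Binary.Sublist.Propositional.Properties using (All-resp-⊆)
open import Data.List.Relation.Unary.All as ListAll using ([]; _∷_)
import Data.List.Relation.Unary.All.Properties as ListAll
open import Data.List.Relation.Unary.AllPairs as AllPairs using (AllPairs; []; _∷_)
import Data.List.Relation.Unary.AllPairs.Properties as AllPairs
open import Data.List.Relation.Unary.Any as Any using (here; there)
open import Data.List.Relation.Unary.Unique.Propositional using (Unique)
import Data.List.Relation.Unary.Unique.Propositional.Properties as Unique
open import Data.Nat.Base as ℕ using (ℕ; zero; suc; _≤_; _<_; _*_; _∸_; _!; s≤s)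
open import Data.Nat.Induction using (<-rec)
import Data.Nat.Properties as ℕ
open import Data.Nat.Solver using () renaming (module +-*-Solver to ℕ-Solver)
open import Data.Product.Base as Product using (∃; _×_; _,_; proj₁)
open import Data.Rational.Base as ℚ using (ℚ; 0ℚ; 1ℚ)
import Data.Rational.Properties as ℚ
open import Data.Rational.Solver using () renaming (module +-*-Solver to ℚ-Solver)
open import Data.Rational.Unnormalised.Base using (mkℚᵘ; *≡*)
import Data.Rational.Unnormalised.Properties as ℚᵘ
open import Data.Sum.Base using (inj₁; inj₂)
open import Data.Vec.Base as Vec using (Vec; []; _∷_; toList)
import Data.Vec.Properties as Vec
open import Data.Vec.Relation.Unary.All as VecAll using ([]; _∷_)
import Data.Vec.Relation.Unary.All.Properties as VecAll
open import Data.Vec.Relation.Unary.Linked as Linked using ([]; [-]; _∷_)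
open import Data.Vec.Relation.Unary.Linked.Properties using (Linked⇒All)
open import Function.Base using (_∘_; id; _on_)
open import Function.Bundles using (_⇔_; mk⇔; Equivalence)
open import Level using (Level)
open import Relation.Binary.PropositionalEquality
open import Relation.Nullary using (¬_; Dec; does; yes; no; ¬?; _×-dec_; contradiction)
open import Relation.Nullary.Decidable using (does-⇔)
open import Relation.Unary using (Pred; Decidable; _⊆_)

open import Algebra.Properties.CommutativeMonoid.Sum ℚ.+-0-commutativeMonoid
  using (sum; sum-cong-≗; sum-permute; sum-replicate-zero)
open import Algebra.Properties.Ring (CommutativeRing.ring ℚ.+-*-commutativeRing)
  using (+-cancelʳ)
open import Algebra.Properties.Semiring.Sum (CommutativeRing.semiring ℚ.+-*-commutativeRing)
  using (*-distribˡ-sum; *-distribʳ-sum)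

open ≡-Reasoning

private
  variable
    ℓ : Level
    A B : Set
    k n p : ℕ

-- Integers and reciprocal factorials as rational numbers

infix 9 ⟦_⟧

-- These functions and the sums below are opaque: only their algebraic laws
-- matter, and unfolding them would expose the normalisation of fractions.

opaque

  ⟦_⟧ : ℤ → ℚ
  ⟦ a ⟧ = a ℚ./ 1

  ⟦⟧-0 : ⟦ + 0 ⟧ ≡ 0ℚ
  ⟦⟧-0 = refl

  ⟦⟧-1 : ⟦ + 1 ⟧ ≡ 1ℚ
  ⟦⟧-1 = refl

  ⟦⟧-+ : ∀ a b → ⟦ a ℤ.+ b ⟧ ≡ ⟦ a ⟧ ℚ.+ ⟦ b ⟧
  ⟦⟧-+ a b = ℚ.toℚᵘ-injective (ℚᵘ.≃-trans (ℚ.toℚᵘ-fromℚᵘ (mkℚᵘ (a ℤ.+ b) 0)) (ℚᵘ.≃-sym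
    (ℚᵘ.≃-trans (ℚ.toℚᵘ-homo-+ ⟦ a ⟧ ⟦ b ⟧)
      (ℚᵘ.≃-trans (ℚᵘ.+-cong (ℚ.toℚᵘ-fromℚᵘ (mkℚᵘ a 0)) (ℚ.toℚᵘ-fromℚᵘ (mkℚᵘ b 0)))
        (*≡* (cong (ℤ._* + 1) (cong₂ ℤ._+_ (ℤ.*-identityʳ a) (ℤ.*-identityʳ b))))))))

  ⟦⟧-* : ∀ a b → ⟦ a ℤ.* b ⟧ ≡ ⟦ a ⟧ ℚ.* ⟦ b ⟧
  ⟦⟧-* a b = ℚ.toℚᵘ-injective (ℚᵘ.≃-trans (ℚ.toℚᵘ-fromℚᵘ (mkℚᵘ (a ℤ.* b) 0)) (ℚᵘ.≃-sym
    (ℚᵘ.≃-trans (ℚ.toℚᵘ-homo-* ⟦ a ⟧ ⟦ b ⟧)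
      (ℚᵘ.*-cong (ℚ.toℚᵘ-fromℚᵘ (mkℚᵘ a 0)) (ℚ.toℚᵘ-fromℚᵘ (mkℚᵘ b 0))))))

  ⟦⟧-neg : ∀ a → ⟦ ℤ.- a ⟧ ≡ ℚ.- ⟦ a ⟧
  ⟦⟧-neg a = ℚ.toℚᵘ-injective (ℚᵘ.≃-trans (ℚ.toℚᵘ-fromℚᵘ (mkℚᵘ (ℤ.- a) 0)) (ℚᵘ.≃-sym
    (ℚᵘ.≃-trans (ℚ.toℚᵘ-homo‿- ⟦ a ⟧) (ℚᵘ.-‿cong (ℚ.toℚᵘ-fromℚᵘ (mkℚᵘ a 0))))))

  /-⟦⟧ : ∀ a n .{{_ : ℕ.NonZero n}} → a ℚ./ n ≡ ⟦ a ⟧ ℚ.* (+ 1 ℚ./ n)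
  /-⟦⟧ a (suc n) = ℚ.toℚᵘ-injective (ℚᵘ.≃-trans (ℚ.toℚᵘ-fromℚᵘ (mkℚᵘ a n)) (ℚᵘ.≃-sym
    (ℚᵘ.≃-trans (ℚ.toℚᵘ-homo-* ⟦ a ⟧ (+ 1 ℚ./ suc n))
      (ℚᵘ.≃-trans (ℚᵘ.*-cong (ℚ.toℚᵘ-fromℚᵘ (mkℚᵘ a 0)) (ℚ.toℚᵘ-fromℚᵘ (mkℚᵘ (+ 1) n)))
        (*≡* (cong₂ ℤ._*_ (ℤ.*-identityʳ a) (cong (λ m → + suc m) (sym (ℕ.+-identityʳ n)))))))))

  ⟦n⟧*1/n≡1 : ∀ n .{{_ : ℕ.NonZero n}} → ⟦ + n ⟧ ℚ.* (+ 1 ℚ./ n) ≡ 1ℚ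
  ⟦n⟧*1/n≡1 (suc n) = ℚ.toℚᵘ-injective (ℚᵘ.≃-trans (ℚ.toℚᵘ-homo-* ⟦ + suc n ⟧ (+ 1 ℚ./ suc n))
    (ℚᵘ.≃-trans (ℚᵘ.*-cong (ℚ.toℚᵘ-fromℚᵘ (mkℚᵘ (+ suc n) 0)) (ℚ.toℚᵘ-fromℚᵘ (mkℚᵘ (+ 1) n)))
      (*≡* (begin
        + suc n ℤ.* + 1 ℤ.* + 1  ≡⟨ trans (ℤ.*-identityʳ _) (ℤ.*-identityʳ (+ suc n)) ⟩
        + suc n                  ≡⟨ cong (λ m → + suc m) (ℕ.+-identityʳ n) ⟨
        + suc (n ℕ.+ 0)          ≡⟨ ℤ.*-identityˡ _ ⟨
        + 1 ℤ.* + suc (n ℕ.+ 0)  ∎))))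

  1/!_ : ℕ → ℚ
  1/! n = + 1 /! n

  1/!0 : 1/! 0 ≡ 1ℚ
  1/!0 = refl

  /!-⟦⟧ : ∀ a n → a /! n ≡ ⟦ a ⟧ ℚ.* 1/! n
  /!-⟦⟧ a n = /-⟦⟧ a (n !) {{n ℕ.!≢0}}

  ⟦n!⟧*1/!n≡1 : ∀ n → ⟦ + (n !) ⟧ ℚ.* 1/! n ≡ 1ℚ
  ⟦n!⟧*1/!n≡1 n = ⟦n⟧*1/n≡1 (n !) {{n ℕ.!≢0}}

-- Sums over lists

opaque

  sumOver : List A → (A → ℚ) → ℚ
  sumOver xs f = foldr (λ x s → f x ℚ.+ s) 0ℚ xs

  sumOver-[] : (f : A → ℚ) → sumOver [] f ≡ 0ℚ
  sumOver-[] f = refl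

  sumOver-[-] : ∀ x (f : A → ℚ) → sumOver (x ∷ []) f ≡ f x
  sumOver-[-] x f = ℚ.+-identityʳ (f x)

  sumOver-++ : ∀ (xs ys : List A) (f : A → ℚ) →
               sumOver (xs ++ ys) f ≡ sumOver xs f ℚ.+ sumOver ys f
  sumOver-++ []       ys f = sym (ℚ.+-identityˡ _)
  sumOver-++ (x ∷ xs) ys f =
    trans (cong (f x ℚ.+_) (sumOver-++ xs ys f)) (sym (ℚ.+-assoc (f x) _ _))

  sumOver-map : ∀ (g : A → B) xs (f : B → ℚ) → sumOver (List.map g xs) f ≡ sumOver xs (f ∘ g)
  sumOver-map g []       f = refl
  sumOver-map g (x ∷ xs) f = cong (f (g x) ℚ.+_) (sumOver-map g xs f)

  sumOver-concatMap : ∀ (g : A → List B) xs (f : B → ℚ) →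
                      sumOver (concatMap g xs) f ≡ sumOver xs (λ x → sumOver (g x) f)
  sumOver-concatMap g []       f = refl
  sumOver-concatMap g (x ∷ xs) f =
    trans (sumOver-++ (g x) _ f) (cong (sumOver (g x) f ℚ.+_) (sumOver-concatMap g xs f))

  sumOver-cong : ∀ (xs : List A) {f g : A → ℚ} → f ≗ g → sumOver xs f ≡ sumOver xs g
  sumOver-cong []       f≗g = refl
  sumOver-cong (x ∷ xs) f≗g = cong₂ ℚ._+_ (f≗g x) (sumOver-cong xs f≗g)

  sumOver-+ : ∀ (xs : List A) (f g : A → ℚ) →
              sumOver xs (λ x → f x ℚ.+ g x) ≡ sumOver xs f ℚ.+ sumOver xs g
  sumOver-+ []       f g = refl
  sumOver-+ (x ∷ xs) f g = trans (cong (f x ℚ.+ g x ℚ.+_) (sumOver-+ xs f g))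
    (solve 4 (λ a b c d → a :+ b :+ (c :+ d) := a :+ c :+ (b :+ d)) refl (f x) (g x) _ _)
    where open ℚ-Solver using (solve; _:+_; _:=_)

  sumOver-*ˡ : ∀ (xs : List A) r (f : A → ℚ) →
               sumOver xs (λ x → r ℚ.* f x) ≡ r ℚ.* sumOver xs f
  sumOver-*ˡ []       r f = sym (ℚ.*-zeroʳ r)
  sumOver-*ˡ (x ∷ xs) r f =
    trans (cong (r ℚ.* f x ℚ.+_) (sumOver-*ˡ xs r f)) (sym (ℚ.*-distribˡ-+ r (f x) _))

  sumOver-constant : ∀ {xs : List A} {f : A → ℚ} {r} → ListAll.All (λ x → f x ≡ r) xs →
                     sumOver xs f ≡ ⟦ + length xs ⟧ ℚ.* r
  sumOver-constant {r = r}                  []           =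
    sym (trans (cong (ℚ._* r) ⟦⟧-0) (ℚ.*-zeroˡ r))
  sumOver-constant {xs = x ∷ xs} {f = f} (refl ∷ eqs) = begin
    f x ℚ.+ sumOver xs f                    ≡⟨ cong₂ ℚ._+_ (sym (ℚ.*-identityˡ (f x))) (sumOver-constant eqs) ⟩
    1ℚ ℚ.* f x ℚ.+ ⟦ + length xs ⟧ ℚ.* f x  ≡⟨ ℚ.*-distribʳ-+ (f x) 1ℚ ⟦ + length xs ⟧ ⟨
    (1ℚ ℚ.+ ⟦ + length xs ⟧) ℚ.* f x        ≡⟨ cong (λ s → (s ℚ.+ ⟦ + length xs ⟧) ℚ.* f x) ⟦⟧-1 ⟨
    (⟦ + 1 ⟧ ℚ.+ ⟦ + length xs ⟧) ℚ.* f x   ≡⟨ cong (ℚ._* f x) (⟦⟧-+ (+ 1) (+ length xs)) ⟨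
    ⟦ + suc (length xs) ⟧ ℚ.* f x           ∎

  sumOver-↭ : ∀ {xs ys : List A} (f : A → ℚ) → xs ↭ ys → sumOver xs f ≡ sumOver ys f
  sumOver-↭ f ↭.refl                 = refl
  sumOver-↭ f (prep x p)             = cong (f x ℚ.+_) (sumOver-↭ f p)
  sumOver-↭ f (swap {xs} {ys} x y p) = begin
    f x ℚ.+ (f y ℚ.+ sumOver xs f)  ≡⟨ solve 3 (λ a b c → a :+ (b :+ c) := b :+ (a :+ c)) refl (f x) (f y) _ ⟩
    f y ℚ.+ (f x ℚ.+ sumOver xs f)  ≡⟨ cong (λ s → f y ℚ.+ (f x ℚ.+ s)) (sumOver-↭ f p) ⟩
    f y ℚ.+ (f x ℚ.+ sumOver ys f)  ∎
    where open ℚ-Solver using (solve; _:+_; _:=_)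
  sumOver-↭ f (↭.trans p q)          = trans (sumOver-↭ f p) (sumOver-↭ f q)

  sumOver-sum : ∀ (xs : List A) m (f : Fin m → A → ℚ) →
                sumOver xs (λ x → sum λ i → f i x) ≡ sum λ i → sumOver xs (f i)
  sumOver-sum []       m       f = sym (sum-replicate-zero m)
  sumOver-sum (x ∷ xs) zero    f = trans (ℚ.+-identityˡ _) (sumOver-sum xs zero f)
  sumOver-sum (x ∷ xs) (suc m) f = trans (sumOver-+ (x ∷ xs) (f zero) _)
    (cong (sumOver (x ∷ xs) (f zero) ℚ.+_) (sumOver-sum (x ∷ xs) m (f ∘ suc)))

-- Choosing p elements of a list

insertFirst : A → Vec A p × List A → Vec A (suc p) × List A
insertFirst x (V , Z) = x ∷ V , Z

insertSecond : A → Vec A p × List A → Vec A p × List A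
insertSecond x (V , Z) = V , x ∷ Z

-- All ways to choose p positions of X: the chosen elements, in the order of X,
-- together with the list of the other elements.

pick : ∀ p → List A → List (Vec A p × List A)
pick zero    X       = ([] , X) ∷ []
pick (suc p) []      = []
pick (suc p) (x ∷ X) = List.map (insertFirst x) (pick p X) ++ List.map (insertSecond x) (pick (suc p) X)

pick-tooMany : ∀ p (X : List A) → length X < p → pick p X ≡ []
pick-tooMany (suc p) []      _            = refl
pick-tooMany (suc p) (x ∷ X) (s≤s |X|<p)
  rewrite pick-tooMany p X |X|<p | pick-tooMany (suc p) X (ℕ.m<n⇒m<1+n |X|<p) = refl

-- V and Z are complementary sublists of X.

Picked : List A → Vec A p × List A → Set
Picked X (V , Z) = toList V Sublist.⊆ X × Z Sublist.⊆ X × toList V ++ Z ↭ X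

pick-sound : ∀ p (X : List A) → ListAll.All (Picked X) (pick p X)
pick-sound zero    X       = (minimum X , ⊆-refl , ↭-refl) ∷ []
pick-sound (suc p) []      = []
pick-sound (suc p) (x ∷ X) = ListAll.++⁺
  (ListAll.map⁺ (ListAll.map
    (λ (V⊆X , Z⊆X , V++Z↭X) → refl ∷ V⊆X , x ∷ʳ Z⊆X , prep x V++Z↭X)
    (pick-sound p X)))
  (ListAll.map⁺ (ListAll.map
    (λ {(V , Z)} (V⊆X , Z⊆X , V++Z↭X) →
      x ∷ʳ V⊆X , refl ∷ Z⊆X , ↭-trans (shift x (toList V) Z) (prep x V++Z↭X))
    (pick-sound (suc p) X)))

picked-length : ∀ {X : List A} (V : Vec A p) {Z} → toList V ++ Z ↭ X → p ℕ.+ length Z ≡ length X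
picked-length {p = p} {X} V {Z} V++Z↭X = begin
  p ℕ.+ length Z                  ≡⟨ cong (ℕ._+ length Z) (Vec.length-toList V) ⟨
  length (toList V) ℕ.+ length Z  ≡⟨ length-++ (toList V) ⟨
  length (toList V ++ Z)          ≡⟨ ↭-length V++Z↭X ⟩
  length X                        ∎

-- There are (p + q)! / (p! q!) ways to pick p out of p + q elements.

length-pick : ∀ p q (X : List A) → length X ≡ p ℕ.+ q → length (pick p X) * (p ! * q !) ≡ (p ℕ.+ q) !
length-pick zero    q       X       |X| = trans (ℕ.*-identityˡ _) (ℕ.*-identityˡ _)
length-pick (suc p) zero    (x ∷ X) |X| = begin
  length (pick (suc p) (x ∷ X)) * (suc p ! * 1)
    ≡⟨ cong (λ ps → length (List.map (insertFirst x) (pick p X) ++ List.map (insertSecond x) ps) * (suc p ! * 1))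
         (pick-tooMany (suc p) X (s≤s (ℕ.≤-reflexive (trans (ℕ.suc-injective |X|) (ℕ.+-identityʳ p))))) ⟩
  length (List.map (insertFirst x) (pick p X) ++ []) * (suc p ! * 1)
    ≡⟨ cong (_* (suc p ! * 1)) (trans (length-++ (List.map (insertFirst x) (pick p X)))
         (trans (ℕ.+-identityʳ _) (length-map (insertFirst x) (pick p X)))) ⟩
  length (pick p X) * (suc p ! * 1)
    ≡⟨ solve 3 (λ l s f → l :* ((s :* f) :* con 1) := s :* (l :* (f :* con 1)))
         refl (length (pick p X)) (suc p) (p !) ⟩
  suc p * (length (pick p X) * (p ! * 1))
    ≡⟨ cong (suc p *_) (length-pick p 0 X (ℕ.suc-injective |X|)) ⟩
  suc p * (p ℕ.+ 0) !
    ≡⟨ cong (λ n → suc n * (p ℕ.+ 0) !) (ℕ.+-identityʳ p) ⟨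
  (suc p ℕ.+ 0) !
    ∎
  where open ℕ-Solver
length-pick (suc p) (suc q) (x ∷ X) |X| = begin
  length (pick (suc p) (x ∷ X)) * (suc p ! * suc q !)
    ≡⟨ cong (_* (suc p ! * suc q !)) (trans (length-++ (List.map (insertFirst x) (pick p X)))
         (cong₂ ℕ._+_ (length-map (insertFirst x) (pick p X)) (length-map (insertSecond x) (pick (suc p) X)))) ⟩
  (l₁ ℕ.+ l₂) * (suc p ! * suc q !)
    ≡⟨ solve 6 (λ l₁ l₂ s t f g → (l₁ :+ l₂) :* ((s :* f) :* (t :* g)) :=
                                  s :* (l₁ :* (f :* (t :* g))) :+ t :* (l₂ :* ((s :* f) :* g)))
         refl l₁ l₂ (suc p) (suc q) (p !) (q !) ⟩
  suc p * (l₁ * (p ! * suc q !)) ℕ.+ suc q * (l₂ * (suc p ! * q !))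
    ≡⟨ cong₂ (λ a b → suc p * a ℕ.+ suc q * b) (length-pick p (suc q) X |X|′)
         (trans (length-pick (suc p) q X (trans |X|′ (ℕ.+-suc p q))) (cong _! (sym (ℕ.+-suc p q)))) ⟩
  suc p * (p ℕ.+ suc q) ! ℕ.+ suc q * (p ℕ.+ suc q) !
    ≡⟨ ℕ.*-distribʳ-+ ((p ℕ.+ suc q) !) (suc p) (suc q) ⟨
  (suc p ℕ.+ suc q) !
    ∎
  where
  open ℕ-Solver
  |X|′ = ℕ.suc-injective |X|
  l₁ = length (pick p X)
  l₂ = length (pick (suc p) X)

pick-map : ∀ (f : A → B) p X →
           pick p (List.map f X) ≡ List.map (Product.map (Vec.map f) (List.map f)) (pick p X)
pick-map f zero    X       = refl
pick-map f (suc p) []      = refl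
pick-map f (suc p) (x ∷ X) = begin
  List.map (insertFirst (f x)) (pick p (List.map f X)) ++ List.map (insertSecond (f x)) (pick (suc p) (List.map f X))
    ≡⟨ cong₂ (λ ps qs → List.map (insertFirst (f x)) ps ++ List.map (insertSecond (f x)) qs)
         (pick-map f p X) (pick-map f (suc p) X) ⟩
  List.map (insertFirst (f x)) (List.map f′ (pick p X)) ++ List.map (insertSecond (f x)) (List.map f′ (pick (suc p) X))
    ≡⟨ cong₂ _++_ (trans (sym (map-∘ (pick p X))) (map-∘ (pick p X)))
                  (trans (sym (map-∘ (pick (suc p) X))) (map-∘ (pick (suc p) X))) ⟩
  List.map f′ (List.map (insertFirst x) (pick p X)) ++ List.map f′ (List.map (insertSecond x) (pick (suc p) X))
    ≡⟨ map-++ f′ (List.map (insertFirst x) (pick p X)) _ ⟨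
  List.map f′ (pick (suc p) (x ∷ X))
    ∎
  where
  f′ : ∀ {p} → Vec _ p × List _ → Vec _ p × List _
  f′ = Product.map (Vec.map f) (List.map f)

opaque

  sumPick : ∀ p → List A → (Vec A p → List A → ℚ) → ℚ
  sumPick p X g = sumOver (pick p X) λ (V , Z) → g V Z

  sumPick-0 : ∀ (X : List A) (g : Vec A 0 → List A → ℚ) → sumPick 0 X g ≡ g [] X
  sumPick-0 X g = sumOver-[-] ([] , X) _

  sumPick-tooMany : ∀ p (X : List A) (g : Vec A p → List A → ℚ) → length X < p → sumPick p X g ≡ 0ℚ
  sumPick-tooMany p X g |X|<p = trans (cong (λ ps → sumOver ps _) (pick-tooMany p X |X|<p)) (sumOver-[] _)

  sumPick-∷ : ∀ p x (X : List A) (g : Vec A (suc p) → List A → ℚ) → sumPick (suc p) (x ∷ X) g ≡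
              sumPick p X (λ V Z → g (x ∷ V) Z) ℚ.+ sumPick (suc p) X (λ V Z → g V (x ∷ Z))
  sumPick-∷ p x X g = trans (sumOver-++ (List.map (insertFirst x) (pick p X)) _ _)
    (cong₂ ℚ._+_ (sumOver-map (insertFirst x) (pick p X) _) (sumOver-map (insertSecond x) (pick (suc p) X) _))

  sumPick-map : ∀ (f : A → B) p X (g : Vec B p → List B → ℚ) →
                sumPick p (List.map f X) g ≡ sumPick p X (λ V Z → g (Vec.map f V) (List.map f Z))
  sumPick-map f p X g = trans (cong (λ ps → sumOver ps _) (pick-map f p X)) (sumOver-map _ (pick p X) _)

  sumPick-cong : ∀ p (X : List A) {f g : Vec A p → List A → ℚ} → (∀ V Z → f V Z ≡ g V Z) →
                 sumPick p X f ≡ sumPick p X g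
  sumPick-cong p X f≗g = sumOver-cong (pick p X) λ (V , Z) → f≗g V Z

  sumPick-+ : ∀ p (X : List A) (f g : Vec A p → List A → ℚ) →
              sumPick p X (λ V Z → f V Z ℚ.+ g V Z) ≡ sumPick p X f ℚ.+ sumPick p X g
  sumPick-+ p X f g = sumOver-+ (pick p X) _ _

  sumPick-*ʳ : ∀ p (X : List A) r (f : Vec A p → List A → ℚ) →
               sumPick p X (λ V Z → f V Z ℚ.* r) ≡ sumPick p X f ℚ.* r
  sumPick-*ʳ p X r f = trans (sumPick-cong p X λ V Z → ℚ.*-comm (f V Z) r)
    (trans (sumOver-*ˡ (pick p X) r _) (ℚ.*-comm r (sumPick p X f)))

  sumPick-constant : ∀ p (X : List A) {g : Vec A p → List A → ℚ} {r} →
                     (∀ V Z → Picked X (V , Z) → g V Z ≡ r) →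
                     sumPick p X g ≡ ⟦ + length (pick p X) ⟧ ℚ.* r
  sumPick-constant p X h = sumOver-constant (ListAll.map (λ {(V , Z)} → h V Z) (pick-sound p X))

-- Splitting X into U, V, Z by picking U first and V from the rest is the same
-- as picking U and V together first and then U from what has been picked.

sumPick-exchange : ∀ p q (X : List A) (g : Vec A p → List A → List A → ℚ) →
  sumPick p X (λ U Y → sumPick q Y λ V Z → g U (toList V) Z) ≡
  sumPick (p ℕ.+ q) X (λ W Z → sumPick p (toList W) λ U Y → g U Y Z)
sumPick-exchange zero    q       X       g =
  trans (sumPick-0 X _) (sumPick-cong q X λ V Z → sym (sumPick-0 (toList V) _))
sumPick-exchange (suc p) q       []      g =
  trans (sumPick-tooMany (suc p) [] _ (s≤s ℕ.z≤n)) (sym (sumPick-tooMany (suc p ℕ.+ q) [] _ (s≤s ℕ.z≤n)))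
sumPick-exchange (suc p) zero    (x ∷ X) g = begin
  sumPick (suc p) (x ∷ X) (λ U Y → sumPick 0 Y λ V Z → g U (toList V) Z)
    ≡⟨ sumPick-∷ p x X _ ⟩
  sumPick p X (λ U Y → sumPick 0 Y λ V Z → g (x ∷ U) (toList V) Z) ℚ.+
  sumPick (suc p) X (λ U Y → sumPick 0 (x ∷ Y) λ V Z → g U (toList V) Z)
    ≡⟨ cong (sumPick p X _ ℚ.+_) (sumPick-cong (suc p) X λ U Y →
         trans (sumPick-0 (x ∷ Y) λ V Z → g U (toList V) Z) (sym (sumPick-0 Y λ V Z → g U (toList V) (x ∷ Z)))) ⟩
  sumPick p X (λ U Y → sumPick 0 Y λ V Z → g (x ∷ U) (toList V) Z) ℚ.+
  sumPick (suc p) X (λ U Y → sumPick 0 Y λ V Z → g U (toList V) (x ∷ Z))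
    ≡⟨ cong₂ ℚ._+_ (sumPick-exchange p 0 X λ U → g (x ∷ U))
                   (sumPick-exchange (suc p) 0 X λ U Y Z → g U Y (x ∷ Z)) ⟩
  sumPick (p ℕ.+ 0) X (λ W Z → sumPick p (toList W) λ U Y → g (x ∷ U) Y Z) ℚ.+ r
    ≡⟨ cong (ℚ._+ r) (sumPick-cong (p ℕ.+ 0) X λ W Z → sym (forced W Z)) ⟩
  sumPick (p ℕ.+ 0) X (λ W Z → sumPick (suc p) (x ∷ toList W) λ U Y → g U Y Z) ℚ.+ r
    ≡⟨ sumPick-∷ (p ℕ.+ 0) x X _ ⟨
  sumPick (suc p ℕ.+ 0) (x ∷ X) (λ W Z → sumPick (suc p) (toList W) λ U Y → g U Y Z)
    ∎
  where
  r = sumPick (suc p ℕ.+ 0) X λ W Z → sumPick (suc p) (toList W) λ U Y → g U Y (x ∷ Z)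
  -- As W has only p elements, x is among any suc p elements of x ∷ W.
  forced : (W : Vec _ (p ℕ.+ 0)) (Z : List _) → sumPick (suc p) (x ∷ toList W) (λ U Y → g U Y Z) ≡
           sumPick p (toList W) (λ U Y → g (x ∷ U) Y Z)
  forced W Z = begin
    sumPick (suc p) (x ∷ toList W) (λ U Y → g U Y Z)
      ≡⟨ sumPick-∷ p x (toList W) _ ⟩
    s ℚ.+ sumPick (suc p) (toList W) (λ U Y → g U (x ∷ Y) Z)
      ≡⟨ cong (s ℚ.+_) (sumPick-tooMany (suc p) (toList W) _
           (s≤s (ℕ.≤-reflexive (trans (Vec.length-toList W) (ℕ.+-identityʳ p))))) ⟩
    s ℚ.+ 0ℚ
      ≡⟨ ℚ.+-identityʳ s ⟩
    s ∎
    where s = sumPick p (toList W) λ U Y → g (x ∷ U) Y Z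
-- The three summands are those with x in U, in V and in Z.
sumPick-exchange (suc p) (suc q) (x ∷ X) g = begin
  sumPick (suc p) (x ∷ X) (λ U Y → sumPick (suc q) Y λ V Z → g U (toList V) Z)
    ≡⟨ sumPick-∷ p x X _ ⟩
  l₁ ℚ.+ sumPick (suc p) X (λ U Y → sumPick (suc q) (x ∷ Y) λ V Z → g U (toList V) Z)
    ≡⟨ cong (l₁ ℚ.+_) (trans (sumPick-cong (suc p) X λ U Y → sumPick-∷ q x Y _) (sumPick-+ (suc p) X _ _)) ⟩
  l₁ ℚ.+ (sumPick (suc p) X (λ U Y → sumPick q Y λ V Z → g U (x ∷ toList V) Z) ℚ.+
          sumPick (suc p) X (λ U Y → sumPick (suc q) Y λ V Z → g U (toList V) (x ∷ Z)))
    ≡⟨ cong₂ ℚ._+_ (sumPick-exchange p (suc q) X λ U → g (x ∷ U))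
         (cong₂ ℚ._+_ (sumPick-exchange (suc p) q X λ U Y → g U (x ∷ Y))
                      (sumPick-exchange (suc p) (suc q) X λ U Y Z → g U Y (x ∷ Z))) ⟩
  r₁ ℚ.+ (sumPick (suc p ℕ.+ q) X (λ W → h₂ (toList W)) ℚ.+ r₃)
    ≡⟨ cong (λ n → r₁ ℚ.+ (sumPick n X (λ W → h₂ (toList W)) ℚ.+ r₃)) (sym (ℕ.+-suc p q)) ⟩
  r₁ ℚ.+ (sumPick (p ℕ.+ suc q) X (λ W → h₂ (toList W)) ℚ.+ r₃)
    ≡⟨ ℚ.+-assoc r₁ _ r₃ ⟨
  r₁ ℚ.+ sumPick (p ℕ.+ suc q) X (λ W → h₂ (toList W)) ℚ.+ r₃
    ≡⟨ cong (ℚ._+ r₃) (trans (sumPick-cong (p ℕ.+ suc q) X λ W Z → sumPick-∷ p x (toList W) _)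
                             (sumPick-+ (p ℕ.+ suc q) X _ _)) ⟨
  sumPick (p ℕ.+ suc q) X (λ W Z → sumPick (suc p) (x ∷ toList W) λ U Y → g U Y Z) ℚ.+ r₃
    ≡⟨ sumPick-∷ (p ℕ.+ suc q) x X _ ⟨
  sumPick (suc p ℕ.+ suc q) (x ∷ X) (λ W Z → sumPick (suc p) (toList W) λ U Y → g U Y Z)
    ∎
  where
  l₁ = sumPick p X λ U Y → sumPick (suc q) Y λ V Z → g (x ∷ U) (toList V) Z
  r₁ = sumPick (p ℕ.+ suc q) X λ W Z → sumPick p (toList W) λ U Y → g (x ∷ U) Y Z
  h₂ = λ W Z → sumPick (suc p) W λ U Y → g U (x ∷ Y) Z
  r₃ = sumPick (suc p ℕ.+ suc q) X λ W Z → sumPick (suc p) (toList W) λ U Y → g U Y (x ∷ Z)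

-- Arrangements of a list into columns

-- The arrays with n columns of height k in which the first column is picked
-- from X, the second one from the rest, and so on.  For a sorted X of length
-- n * k these are the arrays with entries X and increasing columns.

arrangements : ∀ n → List A → List (Vec (Vec A k) n)
arrangements         zero    X = [] ∷ []
arrangements {k = k} (suc n) X = concatMap (λ (c , Z) → List.map (c ∷_) (arrangements n Z)) (pick k X)

-- Weights are functions of the list of columns, so that they can be applied
-- to initial and final segments of an array.

opaque
  unfolding sumPick

  sumArrangements : ℕ → List A → (List (Vec A k) → ℚ) → ℚ
  sumArrangements n X w = sumOver (arrangements n X) (w ∘ toList)

  sumArrangements-0 : ∀ (X : List A) (w : List (Vec A k) → ℚ) → sumArrangements 0 X w ≡ w []
  sumArrangements-0 X w = sumOver-[-] [] _

  sumArrangements-suc : ∀ n (X : List A) (w : List (Vec A k) → ℚ) →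
    sumArrangements (suc n) X w ≡ sumPick k X (λ c Z → sumArrangements n Z (w ∘ (c ∷_)))
  sumArrangements-suc {k = k} n X w =
    trans (sumOver-concatMap _ (pick k X) _)
          (sumPick-cong k X λ c Z → sumOver-map (c ∷_) (arrangements n Z) _)

  sumArrangements-cong : ∀ n (X : List A) {v w : List (Vec A k) → ℚ} →
    (∀ (F : Vec (Vec A k) n) → v (toList F) ≡ w (toList F)) → sumArrangements n X v ≡ sumArrangements n X w
  sumArrangements-cong n X v≗w = sumOver-cong (arrangements n X) v≗w

  sumArrangements-*ˡ : ∀ n (X : List A) r (w : List (Vec A k) → ℚ) →
                       sumArrangements n X (λ F → r ℚ.* w F) ≡ r ℚ.* sumArrangements n X w
  sumArrangements-*ˡ n X r w = sumOver-*ˡ (arrangements n X) r _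

  sumArrangements-sum : ∀ n (X : List A) m (f : Fin m → List (Vec A k) → ℚ) →
    sumArrangements n X (λ F → sum λ i → f i F) ≡ sum λ i → sumArrangements n X (f i)
  sumArrangements-sum n X m f = sumOver-sum (arrangements n X) m _

sumArrangements-map : ∀ (f : A → B) n X (w : List (Vec B k) → ℚ) →
  sumArrangements n (List.map f X) w ≡ sumArrangements n X (w ∘ List.map (Vec.map f))
sumArrangements-map         f zero    X w = trans (sumArrangements-0 (List.map f X) w) (sym (sumArrangements-0 X _))
sumArrangements-map {k = k} f (suc n) X w = begin
  sumArrangements (suc n) (List.map f X) w
    ≡⟨ sumArrangements-suc n (List.map f X) w ⟩
  sumPick k (List.map f X) (λ c Z → sumArrangements n Z (w ∘ (c ∷_)))
    ≡⟨ sumPick-map f k X _ ⟩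
  sumPick k X (λ c Z → sumArrangements n (List.map f Z) (w ∘ (Vec.map f c ∷_)))
    ≡⟨ sumPick-cong k X (λ c Z → sumArrangements-map f n Z (w ∘ (Vec.map f c ∷_))) ⟩
  sumPick k X (λ c Z → sumArrangements n Z (λ F → w (Vec.map f c ∷ List.map (Vec.map f) F)))
    ≡⟨ sumArrangements-suc n X _ ⟨
  sumArrangements (suc n) X (w ∘ List.map (Vec.map f))
    ∎

-- An arrangement into a + b columns is a choice of the entries of the first a
-- columns, an arrangement of these, and an arrangement of the other entries.

sumArrangements-split : ∀ a b (X : List A) (u v : List (Vec A k) → ℚ) →
  sumArrangements (a ℕ.+ b) X (λ F → u (List.take a F) ℚ.* v (List.drop a F)) ≡
  sumPick (a * k) X (λ V Z → sumArrangements a (toList V) u ℚ.* sumArrangements b Z v)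
sumArrangements-split zero    b X u v = begin
  sumArrangements b X (λ F → u [] ℚ.* v F)                 ≡⟨ sumArrangements-*ˡ b X (u []) v ⟩
  u [] ℚ.* sumArrangements b X v                           ≡⟨ cong (ℚ._* sumArrangements b X v) (sumArrangements-0 [] u) ⟨
  sumArrangements 0 [] u ℚ.* sumArrangements b X v         ≡⟨ sumPick-0 X _ ⟨
  sumPick 0 X (λ V Z → sumArrangements 0 (toList V) u ℚ.* sumArrangements b Z v) ∎
sumArrangements-split {k = k} (suc a) b X u v = begin
  sumArrangements (suc a ℕ.+ b) X (λ F → u (List.take (suc a) F) ℚ.* v (List.drop (suc a) F))
    ≡⟨ sumArrangements-suc (a ℕ.+ b) X _ ⟩
  sumPick k X (λ c Y → sumArrangements (a ℕ.+ b) Y λ F → u (c ∷ List.take a F) ℚ.* v (List.drop a F))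
    ≡⟨ sumPick-cong k X (λ c Y → sumArrangements-split a b Y (u ∘ (c ∷_)) v) ⟩
  sumPick k X (λ c Y → sumPick (a * k) Y λ V Z → sumArrangements a (toList V) (u ∘ (c ∷_)) ℚ.* sumArrangements b Z v)
    ≡⟨ sumPick-exchange k (a * k) X (λ c V Z → sumArrangements a V (u ∘ (c ∷_)) ℚ.* sumArrangements b Z v) ⟩
  sumPick (k ℕ.+ a * k) X (λ V Z → sumPick k (toList V) λ c Y → sumArrangements a Y (u ∘ (c ∷_)) ℚ.* sumArrangements b Z v)
    ≡⟨ sumPick-cong (k ℕ.+ a * k) X (λ V Z → trans (sumPick-*ʳ k (toList V) (sumArrangements b Z v) _)
         (cong (ℚ._* sumArrangements b Z v) (sym (sumArrangements-suc a (toList V) u)))) ⟩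
  sumPick (k ℕ.+ a * k) X (λ V Z → sumArrangements (suc a) (toList V) u ℚ.* sumArrangements b Z v)
    ∎

-- Order invariance

Sorted : List ℕ → Set
Sorted = AllPairs _<_

AllPairs-resp-⊆ : ∀ {R : A → A → Set} {X Y} → X Sublist.⊆ Y → AllPairs R Y → AllPairs R X
AllPairs-resp-⊆ []           []       = []
AllPairs-resp-⊆ (y ∷ʳ X⊆Y)   (_ ∷ rs) = AllPairs-resp-⊆ X⊆Y rs
AllPairs-resp-⊆ (refl ∷ X⊆Y) (r ∷ rs) = All-resp-⊆ X⊆Y r ∷ AllPairs-resp-⊆ X⊆Y rs

upTo-sorted : ∀ n → Sorted (upTo n)
upTo-sorted n = AllPairs.applyUpTo⁺₁ id n λ i<j _ → i<j

applyUpTo-suc-sorted : ∀ n → Sorted (applyUpTo suc n)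
applyUpTo-suc-sorted n = AllPairs.applyUpTo⁺₁ suc n λ i<j _ → s≤s i<j

StrictlyMonotone : (ℕ → ℕ) → Set
StrictlyMonotone f = ∀ {i j} → i < j → f i < f j

-- A weight is order invariant if it depends only on the relative order of the
-- entries.

OrderInvariant : (List (Vec ℕ k) → ℚ) → Set
OrderInvariant w = ∀ {f} → StrictlyMonotone f → ∀ F → w (List.map (Vec.map f) F) ≡ w F

-- The function that enumerates X and increases in steps of 1 from there on;
-- m is the value at 0 if X is empty.

extend : ℕ → List ℕ → ℕ → ℕ
extend m []      i       = m ℕ.+ i
extend m (x ∷ X) zero    = x
extend m (x ∷ X) (suc i) = extend (suc x) X i

extend-lowerBound : ∀ {m} X → Sorted X → ListAll.All (m ≤_) X → ∀ i → m ≤ extend m X i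
extend-lowerBound []      _          _         i       = ℕ.m≤m+n _ i
extend-lowerBound (x ∷ X) _          (m≤x ∷ _) zero    = m≤x
extend-lowerBound (x ∷ X) (x<X ∷ X!) (m≤x ∷ _) (suc i) =
  ℕ.≤-trans m≤x (ℕ.<⇒≤ (extend-lowerBound X X! x<X i))

extend-monotone : ∀ {m} X → Sorted X → StrictlyMonotone (extend m X)
extend-monotone {m} []      _          i<j                       = ℕ.+-monoʳ-< m i<j
extend-monotone     (x ∷ X) (x<X ∷ X!) {zero}  {suc j} _         = extend-lowerBound X X! x<X j
extend-monotone     (x ∷ X) (x<X ∷ X!) {suc i} {suc j} (s≤s i<j) = extend-monotone X X! i<j

extend-upTo : ∀ m X → List.map (extend m X) (upTo (length X)) ≡ X
extend-upTo m X = trans (map-applyUpTo id (extend m X) (length X)) (go m X)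
  where
  go : ∀ m X → applyUpTo (extend m X) (length X) ≡ X
  go m []      = refl
  go m (x ∷ X) = cong (x ∷_) (go (suc x) X)

sumArrangements-invariant : ∀ n {X} {w : List (Vec ℕ k) → ℚ} → OrderInvariant w → Sorted X →
  sumArrangements n X w ≡ sumArrangements n (upTo (length X)) w
sumArrangements-invariant n {X} {w} w-inv X! = begin
  sumArrangements n X w                               ≡⟨ cong (λ Y → sumArrangements n Y w) (extend-upTo 0 X) ⟨
  sumArrangements n (List.map f (upTo (length X))) w  ≡⟨ sumArrangements-map f n (upTo (length X)) w ⟩
  sumArrangements n (upTo (length X)) (w ∘ List.map (Vec.map f))
    ≡⟨ sumArrangements-cong n (upTo (length X)) (λ F → w-inv (extend-monotone X X!) (toList F)) ⟩
  sumArrangements n (upTo (length X)) w               ∎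
  where f = extend 0 X

count-monotone : ∀ {f} → StrictlyMonotone f → ∀ x (V : Vec ℕ n) →
                 Vec.count (ℕ._≤? f x) (Vec.map f V) ≡ Vec.count (ℕ._≤? x) V
count-monotone f-mono x [] = refl
count-monotone {f = f} f-mono x (y ∷ V) =
  cong₂ (λ b c → (if b then suc else id) c) (does-⇔ (mk⇔ to from) (f y ℕ.≤? f x) (y ℕ.≤? x)) (count-monotone f-mono x V)
  where
  to : f y ≤ f x → y ≤ x
  to fy≤fx = ℕ.≮⇒≥ λ x<y → ℕ.<⇒≱ (f-mono x<y) fy≤fx
  from : y ≤ x → f y ≤ f x
  from y≤x with ℕ.m≤n⇒m<n∨m≡n y≤x
  ... | inj₁ y<x  = ℕ.<⇒≤ (f-mono y<x)
  ... | inj₂ refl = ℕ.≤-refl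

red-map : ∀ {f} → StrictlyMonotone f → (F : Array k n) → red (Vec.map (Vec.map f) F) ≡ red F
red-map {f = f} f-mono F = begin
  Vec.map (Vec.map (rank F′)) (Vec.map (Vec.map f) F)  ≡⟨ Vec.map-∘ _ _ F ⟨
  Vec.map (Vec.map (rank F′) ∘ Vec.map f) F
    ≡⟨ Vec.map-cong (λ c → trans (sym (Vec.map-∘ _ _ c)) (Vec.map-cong rank-map c)) F ⟩
  Vec.map (Vec.map (rank F)) F                         ∎
  where
  F′ = Vec.map (Vec.map f) F
  rank-map : ∀ x → rank F′ (f x) ≡ rank F x
  rank-map x = trans (cong (Vec.count (ℕ._≤? f x)) (sym (Vec.map-concat f F))) (count-monotone f-mono x (Vec.concat F))

-- Frequencies

-- The sum of w over the arrays with n columns of height k that contain the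
-- numbers 0, …, n * k - 1.  If w is order invariant, any other list of n * k
-- increasing numbers gives the same sum.

total : ∀ k n → (List (Vec ℕ k) → ℚ) → ℚ
total k n w = sumArrangements n (upTo (n * k)) w

-- The total relative to the number of all orderings of the entries, without
-- the restriction to increasing columns.

frequency : ∀ k n → (List (Vec ℕ k) → ℚ) → ℚ
frequency k n w = total k n w ℚ.* 1/! (n * k)

frequency-0 : (w : List (Vec ℕ k) → ℚ) → w [] ≡ 1ℚ → frequency k 0 w ≡ 1ℚ
frequency-0 w w[]≡1 = cong₂ ℚ._*_ (trans (sumArrangements-0 [] w) w[]≡1) 1/!0

frequency-split : ∀ a b {u v : List (Vec ℕ k) → ℚ} → OrderInvariant u → OrderInvariant v →
  frequency k (a ℕ.+ b) (λ F → u (List.take a F) ℚ.* v (List.drop a F)) ≡ frequency k a u ℚ.* frequency k b v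
frequency-split {k = k} a b {u} {v} u-inv v-inv = begin
  total k (a ℕ.+ b) (λ F → u (List.take a F) ℚ.* v (List.drop a F)) ℚ.* r
    ≡⟨ cong (ℚ._* r) (sumArrangements-split a b X u v) ⟩
  sumPick (a * k) X (λ V Z → sumArrangements a (toList V) u ℚ.* sumArrangements b Z v) ℚ.* r
    ≡⟨ cong (ℚ._* r) (sumPick-constant (a * k) X λ V Z (V⊆X , Z⊆X , V++Z↭X) → cong₂ ℚ._*_
         (trans (sumArrangements-invariant a u-inv (AllPairs-resp-⊆ V⊆X X!))
                (cong (λ m → sumArrangements a (upTo m) u) (Vec.length-toList V)))
         (trans (sumArrangements-invariant b v-inv (AllPairs-resp-⊆ Z⊆X X!))
                (cong (λ m → sumArrangements b (upTo m) v)
                  (ℕ.+-cancelˡ-≡ (a * k) _ _ (trans (picked-length V V++Z↭X) |X|))))) ⟩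
  ⟦ + l ⟧ ℚ.* (s ℚ.* t) ℚ.* r
    ≡⟨ trans (cong (ℚ._* (⟦ + l ⟧ ℚ.* (s ℚ.* t) ℚ.* r)) (ℚ.*-identityˡ 1ℚ)) (ℚ.*-identityˡ _) ⟨
  1ℚ ℚ.* 1ℚ ℚ.* (⟦ + l ⟧ ℚ.* (s ℚ.* t) ℚ.* r)
    ≡⟨ cong₂ (λ x y → x ℚ.* y ℚ.* (⟦ + l ⟧ ℚ.* (s ℚ.* t) ℚ.* r)) (⟦n!⟧*1/!n≡1 (a * k)) (⟦n!⟧*1/!n≡1 (b * k)) ⟨
  a! ℚ.* 1/! (a * k) ℚ.* (b! ℚ.* 1/! (b * k)) ℚ.* (⟦ + l ⟧ ℚ.* (s ℚ.* t) ℚ.* r)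
    ≡⟨ solve 8 (λ l s t r f f′ g g′ → f :* f′ :* (g :* g′) :* (l :* (s :* t) :* r) :=
                                      (l :* (f :* g)) :* r :* ((s :* f′) :* (t :* g′)))
         refl ⟦ + l ⟧ s t r a! (1/! (a * k)) b! (1/! (b * k)) ⟩
  ⟦ + l ⟧ ℚ.* (a! ℚ.* b!) ℚ.* r ℚ.* (frequency k a u ℚ.* frequency k b v)
    ≡⟨ cong (λ x → x ℚ.* r ℚ.* (frequency k a u ℚ.* frequency k b v)) choices ⟩
  ⟦ + (((a ℕ.+ b) * k) !) ⟧ ℚ.* r ℚ.* (frequency k a u ℚ.* frequency k b v)
    ≡⟨ cong (ℚ._* (frequency k a u ℚ.* frequency k b v)) (⟦n!⟧*1/!n≡1 ((a ℕ.+ b) * k)) ⟩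
  1ℚ ℚ.* (frequency k a u ℚ.* frequency k b v)
    ≡⟨ ℚ.*-identityˡ _ ⟩
  frequency k a u ℚ.* frequency k b v
    ∎
  where
  open ℚ-Solver using (solve; _:*_; _:=_)
  X = upTo ((a ℕ.+ b) * k)
  X! = upTo-sorted ((a ℕ.+ b) * k)
  |X| : length X ≡ a * k ℕ.+ b * k
  |X| = trans (length-upTo ((a ℕ.+ b) * k)) (ℕ.*-distribʳ-+ k a b)
  r = 1/! ((a ℕ.+ b) * k)
  s = total k a u
  t = total k b v
  l = length (pick (a * k) X)
  a! = ⟦ + ((a * k) !) ⟧
  b! = ⟦ + ((b * k) !) ⟧
  choices : ⟦ + l ⟧ ℚ.* (a! ℚ.* b!) ≡ ⟦ + (((a ℕ.+ b) * k) !) ⟧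
  choices = begin
    ⟦ + l ⟧ ℚ.* (a! ℚ.* b!)
      ≡⟨ cong (⟦ + l ⟧ ℚ.*_) (⟦⟧-* (+ ((a * k) !)) (+ ((b * k) !))) ⟨
    ⟦ + l ⟧ ℚ.* ⟦ + ((a * k) !) ℤ.* + ((b * k) !) ⟧
      ≡⟨ ⟦⟧-* (+ l) _ ⟨
    ⟦ + l ℤ.* (+ ((a * k) !) ℤ.* + ((b * k) !)) ⟧
      ≡⟨ cong ⟦_⟧ (trans (cong (+ l ℤ.*_) (sym (ℤ.pos-* ((a * k) !) ((b * k) !)))) (sym (ℤ.pos-* l _))) ⟩
    ⟦ + (l * ((a * k) ! * (b * k) !)) ⟧
      ≡⟨ cong (⟦_⟧ ∘ +_) (trans (length-pick (a * k) (b * k) X |X|) (cong _! (sym (ℕ.*-distribʳ-+ k a b)))) ⟩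
    ⟦ + (((a ℕ.+ b) * k) !) ⟧
      ∎

total-1 : {w : List (Vec ℕ k) → ℚ} → (∀ c → w (c ∷ []) ≡ 1ℚ) → total k 1 w ≡ 1ℚ
total-1 {k = k} {w} w≡1 = begin
  sumArrangements 1 X w                                   ≡⟨ sumArrangements-suc 0 X w ⟩
  sumPick k X (λ c Z → sumArrangements 0 Z (w ∘ (c ∷_)))  ≡⟨ sumPick-constant k X (λ c Z _ → trans (sumArrangements-0 Z _) (w≡1 c)) ⟩
  ⟦ + length (pick k X) ⟧ ℚ.* 1ℚ                          ≡⟨ ℚ.*-identityʳ _ ⟩
  ⟦ + length (pick k X) ⟧                                 ≡⟨ cong (⟦_⟧ ∘ +_) (ℕ.*-cancelʳ-≡ (length (pick k X)) 1 (k !) {{k ℕ.!≢0}} one) ⟩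
  ⟦ + 1 ⟧                                                 ≡⟨ ⟦⟧-1 ⟩
  1ℚ                                                      ∎
  where
  X = upTo (1 * k)
  one : length (pick k X) * k ! ≡ 1 * k !
  one = begin
    length (pick k X) * k !          ≡⟨ cong (length (pick k X) *_) (ℕ.*-identityʳ (k !)) ⟨
    length (pick k X) * (k ! * 0 !)  ≡⟨ length-pick k 0 X (length-upTo (1 * k)) ⟩
    (k ℕ.+ 0) !                      ≡⟨ cong _! (ℕ.+-identityʳ k) ⟩
    k !                              ≡⟨ ℕ.*-identityˡ (k !) ⟨
    1 * k !                          ∎

-- Fillings as arrangements

sorted⇒increasing : (V : Vec ℕ p) → Sorted (toList V) → Increasing V
sorted⇒increasing []          _                = []
sorted⇒increasing (x ∷ [])    _                = [-]
sorted⇒increasing (x ∷ y ∷ V) ((x<y ∷ _) ∷ V!) = x<y ∷ sorted⇒increasing (y ∷ V) V!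

increasing⇒sorted : {V : Vec ℕ p} → Increasing V → Sorted (toList V)
increasing⇒sorted []         = []
increasing⇒sorted [-]        = [] ∷ []
increasing⇒sorted (x<y ∷ V↑) = VecAll.toList⁺ (Linked⇒All ℕ.<-trans x<y V↑) ∷ increasing⇒sorted V↑

arrangements-sound : ∀ n {X} → Sorted X → length X ≡ n * k →
  ListAll.All (λ F → entries {k} F ↭ X × VecAll.All Increasing F) (arrangements n X)
arrangements-sound         zero    {[]} X! |X| = (↭-refl , []) ∷ []
arrangements-sound {k = k} (suc n) {X}  X! |X| =
  ListAll.concat⁺ (ListAll.map⁺ (ListAll.map
    (λ {(c , Z)} (c⊆X , Z⊆X , c++Z↭X) → ListAll.map⁺ (ListAll.map
      (λ {F} (F↭Z , F↑) →
        subst (_↭ X) (sym (Vec.toList-++ c (Vec.concat F))) (↭-trans (++⁺ˡ (toList c) F↭Z) c++Z↭X) ,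
        sorted⇒increasing c (AllPairs-resp-⊆ c⊆X X!) ∷ F↑)
      (arrangements-sound n (AllPairs-resp-⊆ Z⊆X X!)
        (ℕ.+-cancelˡ-≡ k _ _ (trans (picked-length c c++Z↭X) |X|)))))
    (pick-sound k X)))

-- The least element of X is either the bottom of the column c or not in c.

pick-complete : ∀ {X} (c : Vec ℕ p) ys → Sorted X → Increasing c → toList c ++ ys ↭ X →
                ∃ λ Z → (c , Z) ∈ pick p X × ys ↭ Z
pick-complete {X = X}     []      ys X!         _  ys↭X    = X , here refl , ys↭X
pick-complete {X = []}    (y ∷ c) ys X!         _  c++ys↭X = contradiction c++ys↭X ¬x∷xs↭[]
pick-complete {X = x ∷ X} (y ∷ c) ys (x<X ∷ X!) c↑ c++ys↭X with y ℕ.≟ x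
... | yes refl =
  let Z , c,Z∈ , ys↭Z = pick-complete c ys X! (Linked.tail c↑) (drop-∷ c++ys↭X)
  in  Z , ∈-++⁺ˡ (∈-map⁺ (insertFirst x) c,Z∈) , ys↭Z
... | no  y≢x with ∈-++⁻ (y ∷ toList c) (∈-resp-↭ (↭-sym c++ys↭X) (here refl))
...   | inj₁ (here x≡y)  = contradiction (sym x≡y) y≢x
...   | inj₁ (there x∈c) = contradiction (ListAll.lookup (AllPairs.head (increasing⇒sorted c↑)) x∈c) (ℕ.<-asym x<y)
  where
  x<y : x < y
  x<y with ∈-resp-↭ c++ys↭X (here refl)
  ... | here y≡x  = contradiction y≡x y≢x
  ... | there y∈X = ListAll.lookup x<X y∈X
...   | inj₂ x∈ys with ∈-∃++ x∈ys
...     | as , bs , refl =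
  let c++ys↭x∷rest = ↭-trans (++⁺ˡ (y ∷ toList c) (shift x as bs)) (shift x (y ∷ toList c) (as ++ bs))
      Z , c,Z∈ , as++bs↭Z =
        pick-complete (y ∷ c) (as ++ bs) X! c↑ (drop-∷ (↭-trans (↭-sym c++ys↭x∷rest) c++ys↭X))
  in  x ∷ Z , ∈-++⁺ʳ (List.map (insertFirst x) (pick _ X)) (∈-map⁺ (insertSecond x) c,Z∈) ,
      ↭-trans (shift x as bs) (prep x as++bs↭Z)

arrangements-complete : ∀ {X} → Sorted X → (F : Array k n) → entries F ↭ X → VecAll.All Increasing F →
                        F ∈ arrangements n X
arrangements-complete X! []      F↭X []        = here refl
arrangements-complete {k = k} {X = X} X! (c ∷ F) F↭X (c↑ ∷ F↑) =
  let Z , c,Z∈ , F↭Z = pick-complete c (entries F) X! c↑ (subst (_↭ X) (Vec.toList-++ c (Vec.concat F)) F↭X)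
      _ , Z⊆X , _ = ListAll.lookup (pick-sound k X) c,Z∈
  in  ∈-concatMap⁺ (λ (c , Z) → List.map (c ∷_) (arrangements _ Z)) (Any.map
        (λ { refl → ∈-map⁺ (c ∷_) (arrangements-complete (AllPairs-resp-⊆ Z⊆X X!) F F↭Z F↑) }) c,Z∈)

pick-distinct : ∀ p {X : List A} → Unique X → AllPairs (_≢_ on proj₁) (pick p X)
pick-distinct zero            X!         = [] ∷ []
pick-distinct (suc p) {[]}    []         = []
pick-distinct (suc p) {x ∷ X} (x∉X ∷ X!) = AllPairs.++⁺
  (AllPairs.map⁺ (AllPairs.map (λ V≢W → V≢W ∘ Vec.∷-injectiveʳ) (pick-distinct p X!)))
  (AllPairs.map⁺ (pick-distinct (suc p) X!))
  (ListAll.map⁺ (ListAll.universal (λ (V , Z) → ListAll.map⁺ (ListAll.map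
    (λ { {(y ∷ W , _)} (W⊆X , _) x∷V≡y∷W →
      ListAll.lookup x∉X (Sublist.lookup W⊆X (here refl)) (Vec.∷-injectiveˡ x∷V≡y∷W) })
    (pick-sound (suc p) X))) _))

arrangements-unique : ∀ n {X : List ℕ} → Unique X → Unique (arrangements {k = k} n X)
arrangements-unique         zero        X! = [] ∷ []
arrangements-unique {k = k} (suc n) {X} X! = Unique.concat⁺
  (ListAll.map⁺ (ListAll.map (λ {(c , Z)} (_ , Z⊆X , _) →
    Unique.map⁺ Vec.∷-injectiveʳ (arrangements-unique n (AllPairs-resp-⊆ Z⊆X X!))) (pick-sound k X)))
  (AllPairs.map⁺ (AllPairs.map (λ c≢d {F} (F∈c , F∈d) →
    c≢d (trans (sym (firstColumn F∈c)) (firstColumn F∈d))) (pick-distinct k X!)))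
  where
  firstColumn : ∀ {c : Vec ℕ k} {Fs} {F : Array k (suc n)} → F ∈ List.map (c ∷_) Fs → Vec.head F ≡ c
  firstColumn F∈ with ∈-map⁻ _ F∈
  ... | _ , _ , refl = refl

fillings↭arrangements : ∀ n k → fillings n k ↭ arrangements n (applyUpTo suc (k * n))
fillings↭arrangements n k = ∼bag⇒↭ (unique∧set⇒bag (fillings-unique n k)
  (arrangements-unique n (AllPairs.map ℕ.<⇒≢ X!))
  (λ {F} → mk⇔
    (λ F∈ → let F↭X , F↑ = Equivalence.to (∈-fillings F) F∈ in arrangements-complete X! F F↭X F↑)
    (λ F∈ → Equivalence.from (∈-fillings F)
      (ListAll.lookup (arrangements-sound n X! (trans (length-applyUpTo suc (k * n)) (ℕ.*-comm k n))) F∈))))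
  where X! = applyUpTo-suc-sorted (k * n)

-- Indicator functions

indicator : Bool → ℚ
indicator true  = 1ℚ
indicator false = 0ℚ

indicator-∧ : ∀ a b → indicator (a ∧ b) ≡ indicator a ℚ.* indicator b
indicator-∧ true  b = sym (ℚ.*-identityˡ _)
indicator-∧ false b = sym (ℚ.*-zeroˡ (indicator b))

indicator-not : ∀ a → indicator (not a) ≡ 1ℚ ℚ.- indicator a
indicator-not true  = refl
indicator-not false = refl

opaque
  unfolding sumOver sumArrangements

  ⟦length-filter⟧ : ∀ {P : Pred A ℓ} (P? : Decidable P) xs →
                    ⟦ + length (filter P? xs) ⟧ ≡ sumOver xs (indicator ∘ does ∘ P?)
  ⟦length-filter⟧ P? []       = ⟦⟧-0
  ⟦length-filter⟧ P? (x ∷ xs) with does (P? x)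
  ... | true  = trans (⟦⟧-+ (+ 1) (+ length (filter P? xs))) (cong₂ ℚ._+_ ⟦⟧-1 (⟦length-filter⟧ P? xs))
  ... | false = trans (⟦length-filter⟧ P? xs) (sym (ℚ.+-identityˡ _))

  ⟦length-filter-fillings⟧ : ∀ n {w : List (Vec ℕ k) → ℚ} {P : Pred (Array k n) ℓ} (P? : Decidable P) →
    OrderInvariant w → (∀ F → w (toList F) ≡ indicator (does (P? F))) →
    ⟦ + length (filter P? (fillings n k)) ⟧ ≡ total k n w
  ⟦length-filter-fillings⟧ {k = k} n {w} P? w-inv w≡P = begin
    ⟦ + length (filter P? (fillings n k)) ⟧
      ≡⟨ ⟦length-filter⟧ P? (fillings n k) ⟩
    sumOver (fillings n k) (indicator ∘ does ∘ P?)
      ≡⟨ sumOver-cong (fillings n k) (sym ∘ w≡P) ⟩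
    sumOver (fillings n k) (w ∘ toList)
      ≡⟨ sumOver-↭ (w ∘ toList) (fillings↭arrangements n k) ⟩
    sumArrangements n (applyUpTo suc (k * n)) w
      ≡⟨ sumArrangements-invariant n w-inv (applyUpTo-suc-sorted (k * n)) ⟩
    sumArrangements n (upTo (length (applyUpTo suc (k * n)))) w
      ≡⟨ cong (λ m → sumArrangements n (upTo m) w) (trans (length-applyUpTo suc (k * n)) (ℕ.*-comm k n)) ⟩
    total k n w
      ∎

-- Parity

data Parity : ℕ → Set where
  even : ∀ i → Parity (2 * i)
  odd  : ∀ i → Parity (suc (2 * i))

parity : ∀ m → Parity m
parity zero    = even 0
parity (suc m) with parity m
... | even i = odd i
... | odd i  = subst Parity (ℕ.*-suc 2 i) (even (suc i))

2*suc∸1 : ∀ i → 2 * suc i ∸ 1 ≡ suc (2 * i)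
2*suc∸1 i = cong (_∸ 1) (ℕ.*-suc 2 i)

-- The value of b after it has been negated m times.

flips : Bool → ℕ → Bool
flips b zero    = b
flips b (suc m) = flips (not b) m

flips-2* : ∀ b i → flips b (2 * i) ≡ b
flips-2* b     zero    = refl
flips-2* true  (suc i) = trans (cong (flips true) (ℕ.*-suc 2 i)) (flips-2* true i)
flips-2* false (suc i) = trans (cong (flips false) (ℕ.*-suc 2 i)) (flips-2* false i)

-- Alternating fillings and fillings with matches everywhere

-- P or its negation; turnWeight does the same to an indicator.

Turn : Bool → Set ℓ → Set ℓ
Turn true  P = P
Turn false P = ¬ P

turn? : ∀ b {P : Set ℓ} → Dec P → Dec (Turn b P)
turn? true  P? = P?
turn? false P? = ¬? P?

turnWeight : Bool → ℚ → ℚ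
turnWeight true  m = m
turnWeight false m = 1ℚ ℚ.- m

indicator-turn : ∀ b {P : Set ℓ} (P? : Dec P) → indicator (does (turn? b P?)) ≡ turnWeight b (indicator (does P?))
indicator-turn true  P? = refl
indicator-turn false P? = indicator-not (does P?)

module Weights {k : ℕ} {Υ : Pred (Array k 2) ℓ} (Υ? : Decidable Υ) where

  matchWeight : Vec ℕ k → Vec ℕ k → ℚ
  matchWeight c d = indicator (does (Υ? (red (c ∷ d ∷ []))))

  -- The indicator of having matches at every position.

  fullWeight : List (Vec ℕ k) → ℚ
  fullWeight []          = 1ℚ
  fullWeight (c ∷ [])    = 1ℚ
  fullWeight (c ∷ d ∷ F) = matchWeight c d ℚ.* fullWeight (d ∷ F)

  -- The indicator of having alternately a match and no match, starting with a
  -- match if b is true and with no match otherwise.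

  altWeight : Bool → List (Vec ℕ k) → ℚ
  altWeight b []          = 1ℚ
  altWeight b (c ∷ [])    = 1ℚ
  altWeight b (c ∷ d ∷ F) = turnWeight b (matchWeight c d) ℚ.* altWeight (not b) (d ∷ F)

  matchWeight-map : ∀ {f} → StrictlyMonotone f → ∀ c d → matchWeight (Vec.map f c) (Vec.map f d) ≡ matchWeight c d
  matchWeight-map f-mono c d = cong (indicator ∘ does ∘ Υ?) (red-map f-mono (c ∷ d ∷ []))

  fullWeight-invariant : OrderInvariant fullWeight
  fullWeight-invariant f-mono []          = refl
  fullWeight-invariant f-mono (c ∷ [])    = refl
  fullWeight-invariant f-mono (c ∷ d ∷ F) =
    cong₂ ℚ._*_ (matchWeight-map f-mono c d) (fullWeight-invariant f-mono (d ∷ F))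

  altWeight-invariant : ∀ b → OrderInvariant (altWeight b)
  altWeight-invariant b f-mono []          = refl
  altWeight-invariant b f-mono (c ∷ [])    = refl
  altWeight-invariant b f-mono (c ∷ d ∷ F) =
    cong₂ ℚ._*_ (cong (turnWeight b) (matchWeight-map f-mono c d)) (altWeight-invariant (not b) f-mono (d ∷ F))

  matchesEverywhere-∷ : ∀ c d (F : Array k n) →
    MatchesEverywhere Υ (c ∷ d ∷ F) ⇔ (Υ (red (c ∷ d ∷ [])) × MatchesEverywhere Υ (d ∷ F))
  matchesEverywhere-∷ c d F = mk⇔ (λ h → h zero , h ∘ suc) λ { (m , h) zero → m ; (m , h) (suc p) → h p }

  fullWeight-indicator : (F : Array k n) → fullWeight (toList F) ≡ indicator (does (matchesEverywhere? Υ? F))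
  fullWeight-indicator []          = refl
  fullWeight-indicator (c ∷ [])    = refl
  fullWeight-indicator (c ∷ d ∷ F) = begin
    matchWeight c d ℚ.* fullWeight (toList (d ∷ F))
      ≡⟨ cong (matchWeight c d ℚ.*_) (fullWeight-indicator (d ∷ F)) ⟩
    matchWeight c d ℚ.* indicator (does (matchesEverywhere? Υ? (d ∷ F)))
      ≡⟨ indicator-∧ (does (Υ? (red (c ∷ d ∷ [])))) (does (matchesEverywhere? Υ? (d ∷ F))) ⟨
    indicator (does (Υ? (red (c ∷ d ∷ [])) ×-dec matchesEverywhere? Υ? (d ∷ F)))
      ≡⟨ cong indicator (does-⇔ (matchesEverywhere-∷ c d F) (matchesEverywhere? Υ? (c ∷ d ∷ F))
           (Υ? (red (c ∷ d ∷ [])) ×-dec matchesEverywhere? Υ? (d ∷ F))) ⟨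
    indicator (does (matchesEverywhere? Υ? (c ∷ d ∷ F)))
      ∎

  -- Alternation with a prescribed first turn, in the form that passes from an
  -- array to the array without its first column.

  Zigzag : Bool → Array k n → Set ℓ
  Zigzag b F = ∀ p → Turn (flips b (toℕ p)) (HasMatchAt Υ F p)

  zigzag? : ∀ b (F : Array k n) → Dec (Zigzag b F)
  zigzag? b F = all? λ p → turn? (flips b (toℕ p)) (Υ? _)

  zigzag-∷ : ∀ b c d (F : Array k n) →
    Zigzag b (c ∷ d ∷ F) ⇔ (Turn b (Υ (red (c ∷ d ∷ []))) × Zigzag (not b) (d ∷ F))
  zigzag-∷ b c d F = mk⇔ (λ h → h zero , h ∘ suc) λ { (m , h) zero → m ; (m , h) (suc p) → h p }

  altWeight-zigzag : ∀ b (F : Array k n) → altWeight b (toList F) ≡ indicator (does (zigzag? b F))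
  altWeight-zigzag b []          = refl
  altWeight-zigzag b (c ∷ [])    = refl
  altWeight-zigzag b (c ∷ d ∷ F) = begin
    turnWeight b (matchWeight c d) ℚ.* altWeight (not b) (toList (d ∷ F))
      ≡⟨ cong₂ ℚ._*_ (sym (indicator-turn b (Υ? (red (c ∷ d ∷ []))))) (altWeight-zigzag (not b) (d ∷ F)) ⟩
    indicator (does (turn? b (Υ? (red (c ∷ d ∷ []))))) ℚ.* indicator (does (zigzag? (not b) (d ∷ F)))
      ≡⟨ indicator-∧ (does (turn? b (Υ? (red (c ∷ d ∷ []))))) (does (zigzag? (not b) (d ∷ F))) ⟨
    indicator (does (turn? b (Υ? (red (c ∷ d ∷ []))) ×-dec zigzag? (not b) (d ∷ F)))
      ≡⟨ cong indicator (does-⇔ (zigzag-∷ b c d F) (zigzag? b (c ∷ d ∷ F))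
           (turn? b (Υ? (red (c ∷ d ∷ []))) ×-dec zigzag? (not b) (d ∷ F))) ⟨
    indicator (does (zigzag? b (c ∷ d ∷ F)))
      ∎

  -- Positions are numbered from 1 on, and elements of Fin from 0 on.

  alternating⇔zigzag : (F : Array k n) → Alternating Υ F ⇔ Zigzag true F
  alternating⇔zigzag F = mk⇔ to from
    where
    turnAt : ∀ {b c} p → b ≡ c → Turn b (HasMatchAt Υ F p) → Turn c (HasMatchAt Υ F p)
    turnAt p refl t = t
    to : Alternating Υ F → Zigzag true F
    to (match , noMatch) p = go (toℕ p) (parity (toℕ p)) refl
      where
      go : ∀ m → Parity m → toℕ p ≡ m → Turn (flips true (toℕ p)) (HasMatchAt Υ F p)
      go _ (even i) p≡2i   = turnAt p (sym (trans (cong (flips true) p≡2i) (flips-2* true i)))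
        (match p i (trans (cong suc p≡2i) (ℕ.+-comm 1 (2 * i))))
      go _ (odd i)  p≡1+2i = turnAt p (sym (trans (cong (flips true) p≡1+2i) (flips-2* false i)))
        (noMatch p (suc i) (trans (cong suc p≡1+2i) (sym (ℕ.*-suc 2 i))))
    from : Zigzag true F → Alternating Υ F
    from z =
      (λ p i eq → turnAt p (trans (cong (flips true) (ℕ.suc-injective (trans eq (ℕ.+-comm (2 * i) 1)))) (flips-2* true i)) (z p)) ,
      (λ p i eq → turnAt p (trans (cong (flips false) eq) (flips-2* false i)) (z p))

  altWeight-indicator : (F : Array k n) → altWeight true (toList F) ≡ indicator (does (alternating? Υ? F))
  altWeight-indicator F = trans (altWeight-zigzag true F)
    (cong indicator (sym (does-⇔ (alternating⇔zigzag F) (alternating? Υ? F) (zigzag? true F))))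

  Alt-total : ∀ n → ⟦ + Alt Υ? n ⟧ ≡ total k n (altWeight true)
  Alt-total n = ⟦length-filter-fillings⟧ n (alternating? Υ?) (altWeight-invariant true) altWeight-indicator

  -- For n = 1 the number of fillings agrees with the convention full 1 = 1.

  full-total : ∀ n → ⟦ + full Υ? n ⟧ ≡ total k n fullWeight
  full-total 0             = ⟦length-filter-fillings⟧ 0 (matchesEverywhere? Υ?) fullWeight-invariant fullWeight-indicator
  full-total 1             = trans ⟦⟧-1 (sym (total-1 λ c → refl))
  full-total (suc (suc n)) = ⟦length-filter-fillings⟧ (suc (suc n)) (matchesEverywhere? Υ?) fullWeight-invariant fullWeight-indicator

-- Cancellation of the cuts of a filling

-- x, y, x, y, x, …

periodic : ℚ → ℚ → ℕ → ℚ
periodic x y 0             = x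
periodic x y 1             = y
periodic x y (suc (suc n)) = periodic x y n

-- x, y, - x, - y, x, …

alternatingSigns : ℚ → ℚ → ℕ → ℚ
alternatingSigns x y 0             = x
alternatingSigns x y 1             = y
alternatingSigns x y (suc (suc n)) = ℚ.- alternatingSigns x y n

isEven isOdd : ℕ → ℚ
isEven = periodic 1ℚ 0ℚ
isOdd  = periodic 0ℚ 1ℚ

periodic-2* : ∀ x y i → periodic x y (2 * i) ≡ x
periodic-2* x y zero    = refl
periodic-2* x y (suc i) = trans (cong (periodic x y) (ℕ.*-suc 2 i)) (periodic-2* x y i)

periodic-suc2* : ∀ x y i → periodic x y (suc (2 * i)) ≡ y
periodic-suc2* x y zero    = refl
periodic-suc2* x y (suc i) = trans (cong (periodic x y ∘ suc) (ℕ.*-suc 2 i)) (periodic-suc2* x y i)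

sign-suc : ∀ i z → ⟦ -1ℤ ℤ.^ suc i ⟧ ℚ.* z ≡ ℚ.- (⟦ -1ℤ ℤ.^ i ⟧ ℚ.* z)
sign-suc i z =
  trans (cong (ℚ._* z) (trans (cong ⟦_⟧ (ℤ.-1*i≡-i (-1ℤ ℤ.^ i))) (⟦⟧-neg (-1ℤ ℤ.^ i))))
        (sym (ℚ.neg-distribˡ-* ⟦ -1ℤ ℤ.^ i ⟧ z))

alternatingSigns-2* : ∀ x y i → alternatingSigns x y (2 * i) ≡ ⟦ -1ℤ ℤ.^ i ⟧ ℚ.* x
alternatingSigns-2* x y zero    = sym (trans (cong (ℚ._* x) ⟦⟧-1) (ℚ.*-identityˡ x))
alternatingSigns-2* x y (suc i) = trans (cong (alternatingSigns x y) (ℕ.*-suc 2 i))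
  (trans (cong ℚ.-_ (alternatingSigns-2* x y i)) (sym (sign-suc i x)))

alternatingSigns-suc2* : ∀ x y i → alternatingSigns x y (suc (2 * i)) ≡ ⟦ -1ℤ ℤ.^ i ⟧ ℚ.* y
alternatingSigns-suc2* x y zero    = sym (trans (cong (ℚ._* y) ⟦⟧-1) (ℚ.*-identityˡ y))
alternatingSigns-suc2* x y (suc i) = trans (cong (alternatingSigns x y ∘ suc) (ℕ.*-suc 2 i))
  (trans (cong ℚ.-_ (alternatingSigns-suc2* x y i)) (sym (sign-suc i y)))

module Recurrence {k : ℕ} {Υ : Pred (Array k 2) ℓ} (Υ? : Decidable Υ) (x y : ℚ) where

  open Weights Υ?

  c : ℕ → ℚ
  c = alternatingSigns x y

  -- The contribution of the cut after i columns of an array F with n columns.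
  -- It vanishes for odd i.

  cut : ℕ → ℕ → List (Vec ℕ k) → ℚ
  cut n i F = isEven i ℚ.* altWeight true (List.take i F) ℚ.* (c (n ∸ i) ℚ.* fullWeight (List.drop i F))

  -- The same for the n columns G that follow an even number of columns ending
  -- with b, where only the alternation from b on is taken into account.

  cutAfter : Vec ℕ k → ℕ → ℕ → List (Vec ℕ k) → ℚ
  cutAfter b n i G = isEven i ℚ.* altWeight false (b ∷ List.take i G) ℚ.* (c (n ∸ i) ℚ.* fullWeight (List.drop i G))

  -- With m the indicator of a match between b and the first column of G, the
  -- cut before G contributes c n · fullWeight G, that is
  -- c n · fullWeight (b ∷ G) plus c n · (1 - m) · fullWeight G.  The second
  -- summand cancels against the remaining cuts because c (n + 2) = - c n,
  -- except that for odd n the last cut leaves over y times the indicator of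
  -- alternation.

  sum-cutAfter : ∀ b (G : Array k n) → sum {suc n} (λ i → cutAfter b n (toℕ i) (toList G)) ≡
    c n ℚ.* fullWeight (b ∷ toList G) ℚ.+ isOdd n ℚ.* y ℚ.* altWeight false (b ∷ toList G)
  sum-cutAfter b [] =
    solve 2 (λ x y → con 1ℚ :* con 1ℚ :* (x :* con 1ℚ) :+ con 0ℚ := x :* con 1ℚ :+ con 0ℚ :* y :* con 1ℚ) refl x y
    where open ℚ-Solver
  sum-cutAfter b (d ∷ []) =
    solve 3 (λ x y m →
      con 1ℚ :* con 1ℚ :* (y :* con 1ℚ) :+ (con 0ℚ :* ((con 1ℚ :- m) :* con 1ℚ) :* (x :* con 1ℚ) :+ con 0ℚ) :=
      y :* (m :* con 1ℚ) :+ con 1ℚ :* y :* ((con 1ℚ :- m) :* con 1ℚ)) refl x y (matchWeight b d)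
    where open ℚ-Solver
  sum-cutAfter {n = suc (suc n)} b (d ∷ e ∷ G) = begin
    1ℚ ℚ.* 1ℚ ℚ.* (c′ ℚ.* f′) ℚ.+ (0ℚ ℚ.* z ℚ.* w ℚ.+ sum (λ i → isEven (toℕ i) ℚ.* (m̄ ℚ.* (m ℚ.* t i)) ℚ.* s i))
      ≡⟨ cong (λ r → 1ℚ ℚ.* 1ℚ ℚ.* (c′ ℚ.* f′) ℚ.+ (0ℚ ℚ.* z ℚ.* w ℚ.+ r)) (trans
           (sum-cong-≗ λ i → solve 5 (λ p m̄ m t s → p :* (m̄ :* (m :* t)) :* s := m̄ :* m :* (p :* t :* s))
             refl (isEven (toℕ i)) m̄ m (t i) (s i))
           (sym (*-distribˡ-sum (m̄ ℚ.* m) (λ i → isEven (toℕ i) ℚ.* t i ℚ.* s i)))) ⟩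
    1ℚ ℚ.* 1ℚ ℚ.* (c′ ℚ.* f′) ℚ.+ (0ℚ ℚ.* z ℚ.* w ℚ.+ m̄ ℚ.* m ℚ.* sum {suc n} (λ i → cutAfter e n (toℕ i) (toList G)))
      ≡⟨ cong (λ r → 1ℚ ℚ.* 1ℚ ℚ.* (c′ ℚ.* f′) ℚ.+ (0ℚ ℚ.* z ℚ.* w ℚ.+ m̄ ℚ.* m ℚ.* r)) (sum-cutAfter e G) ⟩
    1ℚ ℚ.* 1ℚ ℚ.* (c′ ℚ.* f′) ℚ.+
    (0ℚ ℚ.* z ℚ.* w ℚ.+ m̄ ℚ.* m ℚ.* (c n ℚ.* fullWeight (e ∷ toList G) ℚ.+ isOdd n ℚ.* y ℚ.* a))
      ≡⟨ solve 9 (λ c m₀ m f z w q y a →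
           con 1ℚ :* con 1ℚ :* (:- c :* (m :* f)) :+ (con 0ℚ :* z :* w :+ (con 1ℚ :- m₀) :* m :* (c :* f :+ q :* y :* a)) :=
           :- c :* (m₀ :* (m :* f)) :+ q :* y :* ((con 1ℚ :- m₀) :* (m :* a)))
         refl (c n) (matchWeight b d) m (fullWeight (e ∷ toList G)) z w (isOdd n) y a ⟩
    c′ ℚ.* (matchWeight b d ℚ.* f′) ℚ.+ isOdd n ℚ.* y ℚ.* (m̄ ℚ.* (m ℚ.* a))
      ∎
    where
    open ℚ-Solver using (solve; con; _:+_; _:*_; _:-_; :-_; _:=_)
    c′ = c (suc (suc n))
    f′ = fullWeight (d ∷ e ∷ toList G)
    m = matchWeight d e
    m̄ = 1ℚ ℚ.- matchWeight b d
    a = altWeight false (e ∷ toList G)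
    z = altWeight false (b ∷ d ∷ [])
    w = c (suc n) ℚ.* fullWeight (e ∷ toList G)
    t s : Fin (suc n) → ℚ
    t i = altWeight false (e ∷ List.take (toℕ i) (toList G))
    s i = c (n ∸ toℕ i) ℚ.* fullWeight (List.drop (toℕ i) (toList G))

  cutSum-alternating : (F : Array k (suc n)) →
    sum {suc (suc n)} (λ i → cut (suc n) (toℕ i) (toList F)) ≡ isOdd (suc n) ℚ.* y ℚ.* altWeight true (toList F)
  cutSum-alternating (d ∷ []) =
    solve 2 (λ x y →
      con 1ℚ :* con 1ℚ :* (y :* con 1ℚ) :+ (con 0ℚ :* con 1ℚ :* (x :* con 1ℚ) :+ con 0ℚ) :=
      con 1ℚ :* y :* con 1ℚ) refl x y
    where open ℚ-Solver
  cutSum-alternating {n = suc n} (d ∷ e ∷ G) = begin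
    1ℚ ℚ.* 1ℚ ℚ.* (c′ ℚ.* f′) ℚ.+ (0ℚ ℚ.* 1ℚ ℚ.* w ℚ.+ sum (λ i → isEven (toℕ i) ℚ.* (m ℚ.* t i) ℚ.* s i))
      ≡⟨ cong (λ r → 1ℚ ℚ.* 1ℚ ℚ.* (c′ ℚ.* f′) ℚ.+ (0ℚ ℚ.* 1ℚ ℚ.* w ℚ.+ r)) (trans
           (sum-cong-≗ λ i → solve 4 (λ p m t s → p :* (m :* t) :* s := m :* (p :* t :* s))
             refl (isEven (toℕ i)) m (t i) (s i))
           (sym (*-distribˡ-sum m (λ i → isEven (toℕ i) ℚ.* t i ℚ.* s i)))) ⟩
    1ℚ ℚ.* 1ℚ ℚ.* (c′ ℚ.* f′) ℚ.+ (0ℚ ℚ.* 1ℚ ℚ.* w ℚ.+ m ℚ.* sum {suc n} (λ i → cutAfter e n (toℕ i) (toList G)))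
      ≡⟨ cong (λ r → 1ℚ ℚ.* 1ℚ ℚ.* (c′ ℚ.* f′) ℚ.+ (0ℚ ℚ.* 1ℚ ℚ.* w ℚ.+ m ℚ.* r)) (sum-cutAfter e G) ⟩
    1ℚ ℚ.* 1ℚ ℚ.* (c′ ℚ.* f′) ℚ.+
    (0ℚ ℚ.* 1ℚ ℚ.* w ℚ.+ m ℚ.* (c n ℚ.* fullWeight (e ∷ toList G) ℚ.+ isOdd n ℚ.* y ℚ.* a))
      ≡⟨ solve 7 (λ c m f w q y a →
           con 1ℚ :* con 1ℚ :* (:- c :* (m :* f)) :+ (con 0ℚ :* con 1ℚ :* w :+ m :* (c :* f :+ q :* y :* a)) :=
           q :* y :* (m :* a))
         refl (c n) m (fullWeight (e ∷ toList G)) w (isOdd n) y a ⟩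
    isOdd n ℚ.* y ℚ.* (m ℚ.* a)
      ∎
    where
    open ℚ-Solver using (solve; con; _:+_; _:*_; :-_; _:=_)
    c′ = c (suc (suc n))
    f′ = fullWeight (d ∷ e ∷ toList G)
    m = matchWeight d e
    a = altWeight false (e ∷ toList G)
    w = c (suc n) ℚ.* fullWeight (e ∷ toList G)
    t s : Fin (suc n) → ℚ
    t i = altWeight false (e ∷ List.take (toℕ i) (toList G))
    s i = c (n ∸ toℕ i) ℚ.* fullWeight (List.drop (toℕ i) (toList G))

  -- Alt n / (kn)! and full n / (kn)!, see Alt-total and full-total.

  α φ : Series
  α n = frequency k n (altWeight true)
  φ n = frequency k n fullWeight

  evenα cφ : Series
  evenα n = isEven n ℚ.* α n
  cφ n    = c n ℚ.* φ n

  convolution-0 : (evenα ⊛ cφ) 0 ≡ x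
  convolution-0 =
    trans (cong₂ (λ a b → 1ℚ ℚ.* a ℚ.* (x ℚ.* b) ℚ.+ 0ℚ) (frequency-0 (altWeight true) refl) (frequency-0 fullWeight refl))
          (solve 1 (λ x → con 1ℚ :* con 1ℚ :* (x :* con 1ℚ) :+ con 0ℚ := x) refl x)
    where open ℚ-Solver

  convolution-suc : ∀ n → (evenα ⊛ cφ) (suc n) ≡ isOdd (suc n) ℚ.* y ℚ.* α (suc n)
  convolution-suc n = begin
    sum {suc m} (λ i → evenα (toℕ i) ℚ.* cφ (m ∸ toℕ i))
      ≡⟨ sum-cong-≗ term ⟩
    sum {suc m} (λ i → total k m (cut m (toℕ i)) ℚ.* 1/! (m * k))
      ≡⟨ *-distribʳ-sum (1/! (m * k)) (λ (i : Fin (suc m)) → total k m (cut m (toℕ i))) ⟨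
    sum {suc m} (λ i → total k m (cut m (toℕ i))) ℚ.* 1/! (m * k)
      ≡⟨ cong (ℚ._* 1/! (m * k)) (begin
           sum {suc m} (λ i → total k m (cut m (toℕ i)))
             ≡⟨ sumArrangements-sum m (upTo (m * k)) (suc m) (cut m ∘ toℕ) ⟨
           total k m (λ F → sum {suc m} λ i → cut m (toℕ i) F)
             ≡⟨ sumArrangements-cong m (upTo (m * k)) cutSum-alternating ⟩
           total k m (λ F → isOdd m ℚ.* y ℚ.* altWeight true F)
             ≡⟨ sumArrangements-*ˡ m (upTo (m * k)) (isOdd m ℚ.* y) (altWeight true) ⟩
           isOdd m ℚ.* y ℚ.* total k m (altWeight true)
             ∎) ⟩
    isOdd m ℚ.* y ℚ.* total k m (altWeight true) ℚ.* 1/! (m * k)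
      ≡⟨ ℚ.*-assoc (isOdd m ℚ.* y) (total k m (altWeight true)) (1/! (m * k)) ⟩
    isOdd m ℚ.* y ℚ.* α m
      ∎
    where
    open ℚ-Solver using (solve; _:*_; _:=_)
    m = suc n
    term : ∀ (i : Fin (suc m)) → evenα (toℕ i) ℚ.* cφ (m ∸ toℕ i) ≡ frequency k m (cut m (toℕ i))
    term i = begin
      isEven a ℚ.* α a ℚ.* (c b ℚ.* φ b)
        ≡⟨ solve 4 (λ e α c φ → e :* α :* (c :* φ) := e :* c :* (α :* φ)) refl (isEven a) (α a) (c b) (φ b) ⟩
      isEven a ℚ.* c b ℚ.* (α a ℚ.* φ b)
        ≡⟨ cong (isEven a ℚ.* c b ℚ.*_) (frequency-split a b (altWeight-invariant true) fullWeight-invariant) ⟨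
      isEven a ℚ.* c b ℚ.* frequency k (a ℕ.+ b) v
        ≡⟨ cong (λ l → isEven a ℚ.* c b ℚ.* frequency k l v) (ℕ.m+[n∸m]≡n (toℕ≤pred[n] i)) ⟩
      isEven a ℚ.* c b ℚ.* (total k m v ℚ.* 1/! (m * k))
        ≡⟨ ℚ.*-assoc (isEven a ℚ.* c b) (total k m v) (1/! (m * k)) ⟨
      isEven a ℚ.* c b ℚ.* total k m v ℚ.* 1/! (m * k)
        ≡⟨ cong (ℚ._* 1/! (m * k)) (sumArrangements-*ˡ m (upTo (m * k)) (isEven a ℚ.* c b) v) ⟨
      total k m (λ F → isEven a ℚ.* c b ℚ.* v F) ℚ.* 1/! (m * k)
        ≡⟨ cong (ℚ._* 1/! (m * k)) (sumArrangements-cong m (upTo (m * k)) λ F →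
             solve 4 (λ e α c φ → e :* c :* (α :* φ) := e :* α :* (c :* φ))
               refl (isEven a) (altWeight true (List.take a (toList F))) (c b) (fullWeight (List.drop a (toList F)))) ⟩
      frequency k m (cut m a)
        ∎
      where
      a = toℕ i
      b = m ∸ toℕ i
      v : List (Vec ℕ k) → ℚ
      v F = altWeight true (List.take a F) ℚ.* fullWeight (List.drop a F)

-- Formal power series

⊛-comm : ∀ S T → S ⊛ T ≗ T ⊛ S
⊛-comm S T m = begin
  sum {suc m} (λ i → S (toℕ i) ℚ.* T (m ∸ toℕ i))
    ≡⟨ sum-permute (λ i → S (toℕ i) ℚ.* T (m ∸ toℕ i)) reverse ⟩
  sum {suc m} (λ i → S (toℕ (opposite i)) ℚ.* T (m ∸ toℕ (opposite i)))
    ≡⟨ sum-cong-≗ (λ i → trans (ℚ.*-comm (S (toℕ (opposite i))) (T (m ∸ toℕ (opposite i)))) (cong₂ (λ a b → T a ℚ.* S b)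
         (trans (cong (m ∸_) (opposite-prop i)) (ℕ.m∸[m∸n]≡n (toℕ≤pred[n] i))) (opposite-prop i))) ⟩
  sum {suc m} (λ i → T (toℕ i) ℚ.* S (m ∸ toℕ i))
    ∎

⊛-cong : ∀ {S S′ T T′} → S ≗ S′ → T ≗ T′ → S ⊛ T ≗ S′ ⊛ T′
⊛-cong S≗S′ T≗T′ m = sum-cong-≗ {n = suc m} λ i → cong₂ ℚ._*_ (S≗S′ (toℕ i)) (T≗T′ (m ∸ toℕ i))

⊛-cancelˡ : ∀ {R S T} → R 0 ≡ 1ℚ → R ⊛ S ≗ R ⊛ T → S ≗ T
⊛-cancelˡ {R} {S} {T} R₀≡1 RS≗RT = <-rec _ λ m S≡T-below → leading m S≡T-below
  where
  below : ∀ {m j} → j < m → m ∸ suc j < m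
  below {suc m} {j} _ = s≤s (ℕ.m∸n≤m m j)
  leading : ∀ m → (∀ {j} → j < m → S j ≡ T j) → S m ≡ T m
  leading m S≡T-below = begin
    S m          ≡⟨ trans (cong (ℚ._* S m) R₀≡1) (ℚ.*-identityˡ (S m)) ⟨
    R 0 ℚ.* S m  ≡⟨ +-cancelʳ r (R 0 ℚ.* S m) (R 0 ℚ.* T m) (trans (RS≗RT m) (cong (R 0 ℚ.* T m ℚ.+_) (sym tails))) ⟩
    R 0 ℚ.* T m  ≡⟨ trans (cong (ℚ._* T m) R₀≡1) (ℚ.*-identityˡ (T m)) ⟩
    T m          ∎
    where
    r = sum {m} λ i → R (suc (toℕ i)) ℚ.* S (m ∸ suc (toℕ i))
    tails : r ≡ sum {m} λ i → R (suc (toℕ i)) ℚ.* T (m ∸ suc (toℕ i))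
    tails = sum-cong-≗ {n = m} λ i → cong (R (suc (toℕ i)) ℚ.*_) (S≡T-below (below (toℕ<n i)))

t^-≡ : ∀ a {e m} → m ≡ e → (a t^ e) m ≡ a
t^-≡ a {e} {m} m≡e with m ℕ.≟ e
... | yes _  = refl
... | no m≢e = contradiction m≡e m≢e

t^-≢ : ∀ a {e m} → m ≢ e → (a t^ e) m ≡ 0ℚ
t^-≢ a {e} {m} m≢e with m ℕ.≟ e
... | yes m≡e = contradiction m≡e m≢e
... | no _    = refl

sum-zero : {f : Fin n → ℚ} → (∀ i → f i ≡ 0ℚ) → sum f ≡ 0ℚ
sum-zero {n} f≡0 = trans (sum-cong-≗ f≡0) (sum-replicate-zero n)

sum-single : {f : Fin n → ℚ} → ∀ i → (∀ j → j ≢ i → f j ≡ 0ℚ) → sum f ≡ f i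
sum-single {f = f} zero    h =
  trans (cong (f zero ℚ.+_) (sum-zero λ j → h (suc j) λ ())) (ℚ.+-identityʳ (f zero))
sum-single {f = f} (suc i) h =
  trans (cong₂ ℚ._+_ (h zero λ ()) (sum-single i λ j j≢i → h (suc j) λ { refl → j≢i refl })) (ℚ.+-identityˡ (f (suc i)))

∑-hit : ∀ (a : ℕ → ℚ) (e : ℕ → ℕ) {m} i → i < m → m ≡ e (suc i) → (∀ j → e (suc j) ≡ e (suc i) → j ≡ i) →
        ∑ₙ≥₁ (λ n → a n t^ e n) m ≡ a (suc i)
∑-hit a e {m} i i<m m≡e e-inj = begin
  sum {m} (λ j → (a (suc (toℕ j)) t^ e (suc (toℕ j))) m)
    ≡⟨ sum-single i′ (λ j j≢i → t^-≢ _ λ m≡ →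
         j≢i (toℕ-injective (trans (e-inj (toℕ j) (trans (sym m≡) m≡e)) (sym i′≡i)))) ⟩
  (a (suc (toℕ i′)) t^ e (suc (toℕ i′))) m
    ≡⟨ cong (λ l → (a (suc l) t^ e (suc l)) m) i′≡i ⟩
  (a (suc i) t^ e (suc i)) m
    ≡⟨ t^-≡ _ m≡e ⟩
  a (suc i)
    ∎
  where
  i′ = Fin.fromℕ< i<m
  i′≡i = toℕ-fromℕ< i<m

∑-miss : ∀ (a : ℕ → ℚ) (e : ℕ → ℕ) {m} → (∀ j → m ≢ e (suc j)) → ∑ₙ≥₁ (λ n → a n t^ e n) m ≡ 0ℚ
∑-miss a e {m} m≢e = sum-zero {m} λ j → t^-≢ _ (m≢e (toℕ j))

evenSeries≗ : ∀ (a : ℕ → ℚ) {T : Series} → T 0 ≡ 1ℚ → (∀ i → T (2 * suc i) ≡ a (suc i)) →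
              (∀ i → T (suc (2 * i)) ≡ 0ℚ) → 𝟙 ⊕ ∑ₙ≥₁ (λ n → a n t^ (2 * n)) ≗ T
evenSeries≗ a {T} T-0 T-even T-odd m = go (parity m)
  where
  go : ∀ {m} → Parity m → (𝟙 ⊕ ∑ₙ≥₁ (λ n → a n t^ (2 * n))) m ≡ T m
  go (even zero)    = sym T-0
  go (even (suc i)) = trans (ℚ.+-identityˡ _) (trans
    (∑-hit a (2 *_) i (ℕ.m≤m+n (suc i) _) refl λ j eq → ℕ.suc-injective (ℕ.*-cancelˡ-≡ (suc j) (suc i) 2 eq))
    (sym (T-even i)))
  go (odd i)        = trans (ℚ.+-identityˡ _) (trans
    (∑-miss a (2 *_) λ j eq → ℕ.even≢odd (suc j) i (sym eq))
    (sym (T-odd i)))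

oddSeries≗ : ∀ (a : ℕ → ℚ) {T : Series} → (∀ i → T (2 * i) ≡ 0ℚ) → (∀ i → T (suc (2 * i)) ≡ a (suc i)) →
             ∑ₙ≥₁ (λ n → a n t^ (2 * n ∸ 1)) ≗ T
oddSeries≗ a {T} T-even T-odd m = go (parity m)
  where
  go : ∀ {m} → Parity m → ∑ₙ≥₁ (λ n → a n t^ (2 * n ∸ 1)) m ≡ T m
  go (even i) = trans
    (∑-miss a (λ n → 2 * n ∸ 1) λ j eq → ℕ.even≢odd i j (trans eq (2*suc∸1 j)))
    (sym (T-even i))
  go (odd i)  = trans
    (∑-hit a (λ n → 2 * n ∸ 1) i (s≤s (ℕ.m≤m+n i _)) (sym (2*suc∸1 i)) λ j eq →
      ℕ.*-cancelˡ-≡ j i 2 (ℕ.suc-injective (trans (sym (2*suc∸1 j)) (trans eq (2*suc∸1 i)))))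
    (sym (T-odd i))

-- The two generating functions

module GeneratingFunctions {k : ℕ} {Υ : Pred (Array k 2) ℓ} (Υ? : Decidable Υ) where

  open Weights Υ?
  module R₀ = Recurrence Υ? 1ℚ 0ℚ
  module R₁ = Recurrence Υ? 0ℚ 1ℚ
  open R₀ using (α; φ)

  Alt-α : ∀ n {N} → N ≡ n * k → + Alt Υ? n /! N ≡ α n
  Alt-α n {N} N≡nk = begin
    + Alt Υ? n /! N             ≡⟨ /!-⟦⟧ (+ Alt Υ? n) N ⟩
    ⟦ + Alt Υ? n ⟧ ℚ.* 1/! N    ≡⟨ cong₂ (λ a N → a ℚ.* 1/! N) (Alt-total n) N≡nk ⟩
    α n                         ∎

  full-φ : ∀ s n {N} → N ≡ n * k → (s ℤ.* + full Υ? n) /! N ≡ ⟦ s ⟧ ℚ.* φ n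
  full-φ s n {N} N≡nk = begin
    (s ℤ.* + full Υ? n) /! N              ≡⟨ /!-⟦⟧ (s ℤ.* + full Υ? n) N ⟩
    ⟦ s ℤ.* + full Υ? n ⟧ ℚ.* 1/! N       ≡⟨ cong (ℚ._* 1/! N) (⟦⟧-* s (+ full Υ? n)) ⟩
    ⟦ s ⟧ ℚ.* ⟦ + full Υ? n ⟧ ℚ.* 1/! N   ≡⟨ cong₂ (λ a N → ⟦ s ⟧ ℚ.* a ℚ.* 1/! N) (full-total n) N≡nk ⟩
    ⟦ s ⟧ ℚ.* total k n fullWeight ℚ.* 1/! (n * k)
                                          ≡⟨ ℚ.*-assoc ⟦ s ⟧ (total k n fullWeight) (1/! (n * k)) ⟩
    ⟦ s ⟧ ℚ.* φ n                         ∎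

  2kn≡2nk : ∀ n → 2 * k * n ≡ 2 * n * k
  2kn≡2nk n = trans (ℕ.*-assoc 2 k n) (trans (cong (2 *_) (ℕ.*-comm k n)) (sym (ℕ.*-assoc 2 n k)))

  coefD coefS coefN coefO : ℕ → ℚ
  coefD n = (-1ℤ ℤ.^ n ℤ.* + full Υ? (2 * n)) /! (2 * k * n)
  coefS n = + Alt Υ? (2 * n) /! (2 * k * n)
  coefN n = (-1ℤ ℤ.^ (n ∸ 1) ℤ.* + full Υ? (2 * n ∸ 1)) /! (k * (2 * n ∸ 1))
  coefO n = + Alt Υ? (2 * n ∸ 1) /! (k * (2 * n ∸ 1))

  -- The denominator and the even series of the first formula, and the
  -- numerator and the odd series of the second one.

  D S N O : Series
  D = 𝟙 ⊕ ∑ₙ≥₁ (λ n → coefD n t^ (2 * n))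
  S = 𝟙 ⊕ ∑ₙ≥₁ (λ n → coefS n t^ (2 * n))
  N = ∑ₙ≥₁ (λ n → coefN n t^ (2 * n ∸ 1))
  O = ∑ₙ≥₁ (λ n → coefO n t^ (2 * n ∸ 1))

  vanishing : ∀ {s} z → s ≡ 0ℚ → s ℚ.* z ≡ 0ℚ
  vanishing z refl = ℚ.*-zeroˡ z

  D≗cφ : D ≗ R₀.cφ
  D≗cφ = evenSeries≗ coefD
    (trans (ℚ.*-identityˡ (φ 0)) (frequency-0 fullWeight refl))
    (λ i → trans (cong (ℚ._* φ (2 * suc i)) (trans (alternatingSigns-2* 1ℚ 0ℚ (suc i)) (ℚ.*-identityʳ ⟦ -1ℤ ℤ.^ suc i ⟧)))
                 (sym (full-φ (-1ℤ ℤ.^ suc i) (2 * suc i) (2kn≡2nk (suc i)))))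
    (λ i → vanishing (φ (suc (2 * i))) (trans (alternatingSigns-suc2* 1ℚ 0ℚ i) (ℚ.*-zeroʳ ⟦ -1ℤ ℤ.^ i ⟧)))

  S≗evenα : S ≗ R₀.evenα
  S≗evenα = evenSeries≗ coefS
    (trans (ℚ.*-identityˡ (α 0)) (frequency-0 (altWeight true) refl))
    (λ i → trans (cong (ℚ._* α (2 * suc i)) (periodic-2* 1ℚ 0ℚ (suc i)))
             (trans (ℚ.*-identityˡ (α (2 * suc i))) (sym (Alt-α (2 * suc i) (2kn≡2nk (suc i))))))
    (λ i → vanishing (α (suc (2 * i))) (periodic-suc2* 1ℚ 0ℚ i))

  N≗cφ : N ≗ R₁.cφ
  N≗cφ = oddSeries≗ coefN
    (λ i → vanishing (φ (2 * i)) (trans (alternatingSigns-2* 0ℚ 1ℚ i) (ℚ.*-zeroʳ ⟦ -1ℤ ℤ.^ i ⟧)))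
    (λ i → trans (cong₂ (λ s l → s ℚ.* φ l) (trans (alternatingSigns-suc2* 0ℚ 1ℚ i) (ℚ.*-identityʳ ⟦ -1ℤ ℤ.^ i ⟧)) (sym (2*suc∸1 i)))
                 (sym (full-φ (-1ℤ ℤ.^ i) (2 * suc i ∸ 1) (ℕ.*-comm k (2 * suc i ∸ 1)))))

  O≗oddα : O ≗ λ m → isOdd m ℚ.* α m
  O≗oddα = oddSeries≗ coefO
    (λ i → vanishing (α (2 * i)) (periodic-2* 0ℚ 1ℚ i))
    (λ i → trans (cong₂ (λ s l → s ℚ.* α l) (periodic-suc2* 0ℚ 1ℚ i) (sym (2*suc∸1 i)))
             (trans (ℚ.*-identityˡ (α (2 * suc i ∸ 1))) (sym (Alt-α (2 * suc i ∸ 1) (ℕ.*-comm k (2 * suc i ∸ 1))))))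

  D⊛S≗𝟙 : D ⊛ S ≗ 𝟙
  D⊛S≗𝟙 m = trans (⊛-comm D S m) (trans (⊛-cong S≗evenα D≗cφ m) (go m))
    where
    go : R₀.evenα ⊛ R₀.cφ ≗ 𝟙
    go zero    = R₀.convolution-0
    go (suc m) = trans (R₀.convolution-suc m) (vanishing (α (suc m)) (ℚ.*-zeroʳ (isOdd (suc m))))

  N⊛S≗O : N ⊛ S ≗ O
  N⊛S≗O m = trans (⊛-comm N S m) (trans (⊛-cong S≗evenα N≗cφ m) (trans (go m) (sym (O≗oddα m))))
    where
    go : R₀.evenα ⊛ R₁.cφ ≗ λ m → isOdd m ℚ.* α m
    go zero    = trans R₁.convolution-0 (sym (ℚ.*-zeroˡ (α 0)))
    go (suc m) = trans (R₁.convolution-suc m) (cong (ℚ._* α (suc m)) (ℚ.*-identityʳ (isOdd (suc m))))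

  S≗D⁻¹ : S ≗ D ⁻¹
  S≗D⁻¹ = ⊛-cancelˡ {D} refl λ m → trans (D⊛S≗𝟙 m) (sym (⊛-inverseʳ D m))

  O≗N⊛D⁻¹ : O ≗ N ⊛ D ⁻¹
  O≗N⊛D⁻¹ m = trans (sym (N⊛S≗O m)) (⊛-cong {N} (λ _ → refl) S≗D⁻¹ m)

corollary9 : ∀ {ℓ} (k : ℕ) → 1 ≤ k →
    (Υ : Pred (Array k 2) ℓ) (Υ? : Decidable Υ) → Υ ⊆ 𝓕 2 k →
    let D = 𝟙 ⊕ ∑ₙ≥₁ (λ n → ((-1ℤ ℤ.^ n ℤ.* + full Υ? (2 * n)) /! (2 * k * n)) t^ (2 * n)) in
    (𝟙 ⊕ ∑ₙ≥₁ (λ n → (+ Alt Υ? (2 * n) /! (2 * k * n)) t^ (2 * n))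
    ≗ D ⁻¹)
    ×
    (∑ₙ≥₁ (λ n → (+ Alt Υ? (2 * n ∸ 1) /! (k * (2 * n ∸ 1))) t^ (2 * n ∸ 1))
    ≗ ∑ₙ≥₁ (λ n → ((-1ℤ ℤ.^ (n ∸ 1) ℤ.* + full Υ? (2 * n ∸ 1)) /! (k * (2 * n ∸ 1))) t^ (2 * n ∸ 1)) ⊛ D ⁻¹)
corollary9 k _ Υ Υ? _ = S≗D⁻¹ , O≗N⊛D⁻¹
  where open GeneratingFunctions Υ?
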